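{- Let $c\geq 1$ be an integer and define the numbers $\bar a_c(n)$ for $n\geq 0$ by the generating function $$\sum_{n\geq 0}\bar a_c(n)q^n=\frac{f_4^{c-1}}{f_1^2f_2^{2c-3}},\qquad f_k:=\prod_{j\geq 1}(1-q^{jk}),\ |q|<1.$$ Then for all integers $n\geq 0$ and $i\geq 1$, $$\bar a_{3i+2}(3n+2)\equiv 0 \pmod{6},\qquad \bar a_{9i+5}(9n+3)\equiv 0 \pmod{12},\qquad \bar a_{9i+8}(9n+3)\equiv 0 \pmod{12}.$$
   Context: $\bar a_c(n)$ is the number of generalized overcubic partitions of $n$: overpartitions of $n$ (partitions in which the first occurrence of each part size may be overlined) in which each even part may appear in $c$ different colors; its generating function is the one displayed in the claim, with $f_k^m$ denoting $\prod_{j\geq1}(1-q^{jk})^m$. -}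

module Defs where

open import Data.Nat as ℕ using (ℕ; zero; suc)
open import Data.Nat.Divisibility using (_∣?_)
open import Data.Integer as ℤ using (ℤ; +_; -[1+_])
open import Data.List using (List; foldr; map; upTo)
open import Relation.Nullary using (yes; no)

Series : Set
Series = ℕ → ℤ

one : Series
one zero    = + 1
one (suc _) = + 0

_⊛_ : Series → Series → Series
(a ⊛ b) n = foldr ℤ._+_ (+ 0) (map (λ i → a i ℤ.* b (n ℕ.∸ i)) (upTo (suc n)))

infixl 7 _⊛_

-- The series 1 - q^m  (used with m ≥ 1).
oneMinus : ℕ → Series
oneMinus m zero = + 1
oneMinus m (suc n) with suc n ℕ.≟ m
... | yes _ = ℤ.- (+ 1)
... | no  _ = + 0

-- The series 1/(1 - q^m) = Σ_{t ≥ 0} q^{m t}  (used with m ≥ 1).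
geom : ℕ → Series
geom m n with m ∣? n
... | yes _ = + 1
... | no  _ = + 0

prodUpTo : (ℕ → Series) → ℕ → Series
prodUpTo F zero    = one
prodUpTo F (suc N) = F (suc N) ⊛ prodUpTo F N

-- f_k = ∏_{j≥1} (1 - q^{jk}) as a formal power series (k ≥ 1): its n-th
-- coefficient equals that of the finite product over j ≤ n, since the
-- remaining factors are ≡ 1 modulo q^{n+1}.
f : ℕ → Series
f k n = prodUpTo (λ j → oneMinus (j ℕ.* k)) n n

fInv : ℕ → Series
fInv k n = prodUpTo (λ j → geom (j ℕ.* k)) n n

pow : Series → ℕ → Series
pow s zero    = one
pow s (suc m) = s ⊛ pow s m

fPow : ℕ → ℤ → Series
fPow k (+ m)     = pow (f k) m
fPow k -[1+ m ]  = pow (fInv k) (suc m)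

abar : ℕ → ℕ → ℤ
abar c = fPow 4 (+ c ℤ.- + 1) ⊛ fPow 1 (ℤ.- (+ 2)) ⊛ fPow 2 (+ 3 ℤ.- + 2 ℤ.* + c)

{-# OPTIONS --safe #-}

-- Put φ(q) = Σ_{k∈ℤ} q^{k²}.  Gauss' identity f₁²/f₂ = φ(-q) together with
-- φ(q) φ(-q) = φ(-q²)² turns the generating function into φ(q) / φ(-q²)^{c+1}.
-- Modulo 3, cubing is the substitution q ↦ q³, so for c + 1 divisible by 3 the
-- residues modulo 9 of the exponents of non-zero coefficients are governed by
-- those of k² and 2k².  Modulo 4, φ(q) and φ(-q²) are of the form 1 + 2u, hence
-- φ(-q²)² ≡ 1 and the coefficients live on the exponents k² and 2k²;
-- modulo 2 both are 1.
--
-- Gauss' identity follows by letting n → ∞ in Shanks' finite form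
--   Σ_{|k|≤n} (-1)^k x^{k²} = P_n + 2 Σ_{s=1}^{n} (-1)^s x^{s(n+1)} P_n / ((1 + x^s) P_s),
--   P_n = ∏_{j≤n} (1 - x^j)/(1 + x^j),
-- which telescopes in s.  In ℤ[[q]]/(m , q^{M+1}) the terms with s > 0 vanish as
-- soon as n ≥ M, so no limits are needed.

module Submission where

open import Defs
open import Algebra.Bundles using (CommutativeRing)
import Algebra.Properties.AbelianGroup as AbelianGroupProperties
import Algebra.Properties.CommutativeSemiring.Exp as CommutativeExp
import Algebra.Properties.Group as GroupProperties
import Algebra.Properties.Ring as RingProperties
import Algebra.Properties.Semiring.Exp as Exp
import Algebra.Properties.Semiring.Mult.TCOptimised as Mult
import Algebra.Solver.Ring as RingSolver
open import Algebra.Solver.Ring.AlmostCommutativeRing using (fromCommutativeRing; _-Raw-AlmostCommutative⟶_)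
open import Data.Nat as ℕ using (ℕ; zero; suc; _≤_; _<_; z≤n; s≤s; _%_)
import Data.Nat.Properties as ℕ
import Data.Nat.DivMod as ℕ
import Data.Nat.Divisibility as ℕ
import Data.Nat.LCM as ℕ
open import Data.Integer as ℤ using (ℤ; +_; -[1+_])
import Data.Integer.Properties as ℤ
import Data.Integer.DivMod as ℤ
import Data.Integer.Divisibility.Signed as Signed
open import Data.Integer.Tactic.RingSolver using (solve-∀)
open import Data.List using (List; []; _∷_; foldr; map; upTo; applyUpTo)
open import Data.List.Properties using (map-upTo)
open import Data.List.Membership.Propositional using (_∈_; _∉_)
open import Data.List.Membership.Propositional.Properties using (∈-upTo⁺)
open import Data.List.Membership.DecPropositional ℕ._≟_ using (_∈?_)
open import Data.List.Relation.Unary.All as All using (All; all?)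
open import Data.List.Relation.Unary.Any using (here)
open import Data.Maybe using (Maybe; just; nothing)
open import Data.Product using (_×_; _,_; ∃)
open import Data.Sum using (_⊎_; inj₁; inj₂)
open import Function using (_∘_)
open import Level using (0ℓ)
open import Relation.Nullary using (Dec; yes; no; contradiction)
open import Relation.Nullary.Decidable using (from-yes; from-no; ¬?)
open import Relation.Binary.PropositionalEquality using (_≡_; _≢_; refl; sym; trans; cong; cong₂; subst; subst₂; module ≡-Reasoning)
import Relation.Binary.Reasoning.Setoid as SetoidReasoning

-- The ring of formal power series

-- The moduli split as 6 = 2 · 3 and 12 = 4 · 3, and the exponent c + 1 comes from writing the
-- generating function as (f₂/f₁²)(f₄/f₂²)^(c-1), where the first quotient is φ(q)/φ(-q²)² and the
-- second is 1/φ(-q²). For the three families c + 1 is 3(i+1), 9(i+1) - 3 and 9(i+1), so modulo 3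
-- the denominator becomes a series in q³ or q⁹ whose further shape is irrelevant; in the middle
-- case a factor φ(-q²)³ stays in the numerator. What remains is arithmetic of residues: 2 is not a
-- square modulo 3, and 3 is none of k², 2k², k² + 6l² modulo 9.
--
-- The obstacle is that `f k` is not one finite product: each coefficient uses a product of its own
-- length. Fixing the degree M of the coefficient in question and calculating modulo m and q^(M+1)
-- replaces these series by genuine finite products and turns the series identities into identities
-- of one commutative ring, in which q is nilpotent.

infixl 6 _⊕_
infix 8 ⊖_ _∙_

_⊕_ : Series → Series → Series
(a ⊕ b) n = a n ℤ.+ b n

⊖_ : Series → Series
(⊖ a) n = ℤ.- a n

_∙_ : ℤ → Series → Series
(k ∙ a) n = k ℤ.* a n

const : ℤ → Series
const k zero    = k
const k (suc _) = + 0

const-zero : ∀ n → const (+ 0) n ≡ + 0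
const-zero zero    = refl
const-zero (suc _) = refl

tail : Series → Series
tail a n = a (suc n)

⊛-head : ∀ a b → (a ⊛ b) 0 ≡ a 0 ℤ.* b 0
⊛-head a b = ℤ.+-identityʳ (a 0 ℤ.* b 0)

-- Splitting off the term with index 0 leaves a convolution of the same shape one degree lower. The
-- ring laws below follow from this by induction on the degree, without further manipulation of list
-- sums.
⊛-tail : ∀ a b n → (a ⊛ b) (suc n) ≡ a 0 ℤ.* b (suc n) ℤ.+ (tail a ⊛ b) n
⊛-tail a b n = begin
  foldr ℤ._+_ (+ 0) (map t (upTo (suc (suc n))))
    ≡⟨ cong (foldr ℤ._+_ (+ 0)) (map-upTo t (suc (suc n))) ⟩
  a 0 ℤ.* b (suc n) ℤ.+ foldr ℤ._+_ (+ 0) (applyUpTo (t ∘ suc) (suc n))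
    ≡⟨ cong (λ l → a 0 ℤ.* b (suc n) ℤ.+ foldr ℤ._+_ (+ 0) l) (map-upTo (t ∘ suc) (suc n)) ⟨
  a 0 ℤ.* b (suc n) ℤ.+ (tail a ⊛ b) n ∎
  where
  open ≡-Reasoning
  t : ℕ → ℤ
  t i = a i ℤ.* b (suc n ℕ.∸ i)

⊛-congˡ-≡ : ∀ a {b c} → (∀ n → b n ≡ c n) → ∀ n → (b ⊛ a) n ≡ (c ⊛ a) n
⊛-congˡ-≡ a {b} {c} e zero = trans (⊛-head b a) (trans (cong (ℤ._* a 0) (e 0)) (sym (⊛-head c a)))
⊛-congˡ-≡ a {b} {c} e (suc n) = trans (⊛-tail b a n) (trans
  (cong₂ ℤ._+_ (cong (ℤ._* a (suc n)) (e 0)) (⊛-congˡ-≡ a (λ k → e (suc k)) n)) (sym (⊛-tail c a n)))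

-- The mirror image of `⊛-tail`, splitting off the last term. Commutativity needs both, since
-- exchanging the factors exchanges the two ends of the sum.
⊛-init : ∀ a b n → (a ⊛ b) (suc n) ≡ (a ⊛ tail b) n ℤ.+ a (suc n) ℤ.* b 0
⊛-init a b zero = trans (⊛-tail a b 0) (cong₂ ℤ._+_ (sym (⊛-head a (tail b))) (⊛-head (tail a) b))
⊛-init a b (suc n) = begin
  (a ⊛ b) (suc (suc n))
    ≡⟨ ⊛-tail a b (suc n) ⟩
  a 0 ℤ.* b (suc (suc n)) ℤ.+ (tail a ⊛ b) (suc n)
    ≡⟨ cong (λ x → a 0 ℤ.* b (suc (suc n)) ℤ.+ x) (⊛-init (tail a) b n) ⟩
  a 0 ℤ.* b (suc (suc n)) ℤ.+ ((tail a ⊛ tail b) n ℤ.+ a (suc (suc n)) ℤ.* b 0)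
    ≡⟨ ℤ.+-assoc (a 0 ℤ.* b (suc (suc n))) _ _ ⟨
  a 0 ℤ.* b (suc (suc n)) ℤ.+ (tail a ⊛ tail b) n ℤ.+ a (suc (suc n)) ℤ.* b 0
    ≡⟨ cong (ℤ._+ a (suc (suc n)) ℤ.* b 0) (⊛-tail a (tail b) n) ⟨
  (a ⊛ tail b) (suc n) ℤ.+ a (suc (suc n)) ℤ.* b 0 ∎
  where open ≡-Reasoning

⊛-comm : ∀ a b n → (a ⊛ b) n ≡ (b ⊛ a) n
⊛-comm a b zero = trans (⊛-head a b) (trans (ℤ.*-comm (a 0) (b 0)) (sym (⊛-head b a)))
⊛-comm a b (suc n) = begin
  (a ⊛ b) (suc n)                             ≡⟨ ⊛-tail a b n ⟩
  a 0 ℤ.* b (suc n) ℤ.+ (tail a ⊛ b) n        ≡⟨ ℤ.+-comm _ ((tail a ⊛ b) n) ⟩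
  (tail a ⊛ b) n ℤ.+ a 0 ℤ.* b (suc n)        ≡⟨ cong₂ ℤ._+_ (⊛-comm (tail a) b n) (ℤ.*-comm (a 0) _) ⟩
  (b ⊛ tail a) n ℤ.+ b (suc n) ℤ.* a 0        ≡⟨ ⊛-init b a n ⟨
  (b ⊛ a) (suc n)                             ∎
  where open ≡-Reasoning

⊛-distribʳ : ∀ c a b n → ((a ⊕ b) ⊛ c) n ≡ (a ⊛ c ⊕ b ⊛ c) n
⊛-distribʳ c a b zero = trans (⊛-head (a ⊕ b) c)
  (trans (ℤ.*-distribʳ-+ (c 0) (a 0) (b 0)) (sym (cong₂ ℤ._+_ (⊛-head a c) (⊛-head b c))))
⊛-distribʳ c a b (suc n) = begin
  ((a ⊕ b) ⊛ c) (suc n)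
    ≡⟨ ⊛-tail (a ⊕ b) c n ⟩
  (a 0 ℤ.+ b 0) ℤ.* c (suc n) ℤ.+ ((tail a ⊕ tail b) ⊛ c) n
    ≡⟨ cong (λ x → (a 0 ℤ.+ b 0) ℤ.* c (suc n) ℤ.+ x) (⊛-distribʳ c (tail a) (tail b) n) ⟩
  (a 0 ℤ.+ b 0) ℤ.* c (suc n) ℤ.+ ((tail a ⊛ c) n ℤ.+ (tail b ⊛ c) n)
    ≡⟨ rearrange (a 0) (b 0) (c (suc n)) _ _ ⟩
  (a 0 ℤ.* c (suc n) ℤ.+ (tail a ⊛ c) n) ℤ.+ (b 0 ℤ.* c (suc n) ℤ.+ (tail b ⊛ c) n)
    ≡⟨ cong₂ ℤ._+_ (⊛-tail a c n) (⊛-tail b c n) ⟨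
  (a ⊛ c ⊕ b ⊛ c) (suc n) ∎
  where
  open ≡-Reasoning
  rearrange : ∀ x y z u v → (x ℤ.+ y) ℤ.* z ℤ.+ (u ℤ.+ v) ≡ (x ℤ.* z ℤ.+ u) ℤ.+ (y ℤ.* z ℤ.+ v)
  rearrange = solve-∀

-- Needed for associativity: the tail of a product `a ⊛ b` contains the scalar multiple
-- `a 0 ∙ tail b`.
∙-⊛ : ∀ k a b n → (k ∙ a ⊛ b) n ≡ (k ∙ (a ⊛ b)) n
∙-⊛ k a b zero = trans (⊛-head (k ∙ a) b) (trans (ℤ.*-assoc k (a 0) (b 0)) (cong (k ℤ.*_) (sym (⊛-head a b))))
∙-⊛ k a b (suc n) = begin
  (k ∙ a ⊛ b) (suc n)
    ≡⟨ ⊛-tail (k ∙ a) b n ⟩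
  k ℤ.* a 0 ℤ.* b (suc n) ℤ.+ (k ∙ tail a ⊛ b) n
    ≡⟨ cong₂ ℤ._+_ (ℤ.*-assoc k (a 0) (b (suc n))) (∙-⊛ k (tail a) b n) ⟩
  k ℤ.* (a 0 ℤ.* b (suc n)) ℤ.+ k ℤ.* (tail a ⊛ b) n
    ≡⟨ ℤ.*-distribˡ-+ k _ _ ⟨
  k ℤ.* (a 0 ℤ.* b (suc n) ℤ.+ (tail a ⊛ b) n)
    ≡⟨ cong (k ℤ.*_) (⊛-tail a b n) ⟨
  (k ∙ (a ⊛ b)) (suc n) ∎
  where open ≡-Reasoning

⊛-assoc : ∀ a b c n → (a ⊛ b ⊛ c) n ≡ (a ⊛ (b ⊛ c)) n
⊛-assoc a b c zero = begin
  (a ⊛ b ⊛ c) 0              ≡⟨ ⊛-head (a ⊛ b) c ⟩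
  (a ⊛ b) 0 ℤ.* c 0          ≡⟨ cong (ℤ._* c 0) (⊛-head a b) ⟩
  a 0 ℤ.* b 0 ℤ.* c 0        ≡⟨ ℤ.*-assoc (a 0) (b 0) (c 0) ⟩
  a 0 ℤ.* (b 0 ℤ.* c 0)      ≡⟨ cong (a 0 ℤ.*_) (⊛-head b c) ⟨
  a 0 ℤ.* (b ⊛ c) 0          ≡⟨ ⊛-head a (b ⊛ c) ⟨
  (a ⊛ (b ⊛ c)) 0            ∎
  where open ≡-Reasoning
⊛-assoc a b c (suc n) = begin
  (a ⊛ b ⊛ c) (suc n)
    ≡⟨ ⊛-tail (a ⊛ b) c n ⟩
  (a ⊛ b) 0 ℤ.* c (suc n) ℤ.+ (tail (a ⊛ b) ⊛ c) n
    ≡⟨ cong₂ ℤ._+_ (cong (ℤ._* c (suc n)) (⊛-head a b)) (⊛-congˡ-≡ c (⊛-tail a b) n) ⟩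
  a 0 ℤ.* b 0 ℤ.* c (suc n) ℤ.+ ((a 0 ∙ tail b ⊕ tail a ⊛ b) ⊛ c) n
    ≡⟨ cong (λ x → a 0 ℤ.* b 0 ℤ.* c (suc n) ℤ.+ x) (⊛-distribʳ c (a 0 ∙ tail b) (tail a ⊛ b) n) ⟩
  a 0 ℤ.* b 0 ℤ.* c (suc n) ℤ.+ ((a 0 ∙ tail b ⊛ c) n ℤ.+ (tail a ⊛ b ⊛ c) n)
    ≡⟨ cong (λ x → a 0 ℤ.* b 0 ℤ.* c (suc n) ℤ.+ x) (cong₂ ℤ._+_ (∙-⊛ (a 0) (tail b) c n) (⊛-assoc (tail a) b c n)) ⟩
  a 0 ℤ.* b 0 ℤ.* c (suc n) ℤ.+ (a 0 ℤ.* (tail b ⊛ c) n ℤ.+ (tail a ⊛ (b ⊛ c)) n)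
    ≡⟨ rearrange (a 0) (b 0) (c (suc n)) _ _ ⟩
  a 0 ℤ.* (b 0 ℤ.* c (suc n) ℤ.+ (tail b ⊛ c) n) ℤ.+ (tail a ⊛ (b ⊛ c)) n
    ≡⟨ cong (λ x → a 0 ℤ.* x ℤ.+ (tail a ⊛ (b ⊛ c)) n) (⊛-tail b c n) ⟨
  a 0 ℤ.* (b ⊛ c) (suc n) ℤ.+ (tail a ⊛ (b ⊛ c)) n
    ≡⟨ ⊛-tail a (b ⊛ c) n ⟨
  (a ⊛ (b ⊛ c)) (suc n) ∎
  where
  open ≡-Reasoning
  rearrange : ∀ x y z u v → x ℤ.* y ℤ.* z ℤ.+ (x ℤ.* u ℤ.+ v) ≡ x ℤ.* (y ℤ.* z ℤ.+ u) ℤ.+ v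
  rearrange = solve-∀

⊛-zeroˡ : ∀ b n → (const (+ 0) ⊛ b) n ≡ + 0
⊛-zeroˡ b zero    = trans (⊛-head (const (+ 0)) b) (ℤ.*-zeroˡ (b 0))
⊛-zeroˡ b (suc n) = trans (⊛-tail (const (+ 0)) b n)
  (cong₂ ℤ._+_ (ℤ.*-zeroˡ (b (suc n)))
    (trans (⊛-congˡ-≡ b {const (+ 0) ∘ suc} {const (+ 0)} (λ { zero → refl ; (suc _) → refl }) n) (⊛-zeroˡ b n)))

const-⊛ : ∀ k b n → (const k ⊛ b) n ≡ k ℤ.* b n
const-⊛ k b zero    = ⊛-head (const k) b
const-⊛ k b (suc n) = trans (⊛-tail (const k) b n) (trans
  (cong (λ x → k ℤ.* b (suc n) ℤ.+ x)
    (trans (⊛-congˡ-≡ b {const k ∘ suc} {const (+ 0)} (λ { zero → refl ; (suc _) → refl }) n) (⊛-zeroˡ b n)))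
  (ℤ.+-identityʳ _))

one-const : ∀ n → one n ≡ const (+ 1) n
one-const zero    = refl
one-const (suc _) = refl

⊛-identityˡ : ∀ b n → (one ⊛ b) n ≡ b n
⊛-identityˡ b n = trans (⊛-congˡ-≡ b one-const n) (trans (const-⊛ (+ 1) b n) (ℤ.*-identityˡ (b n)))

-- Congruences of integers and truncated power series

module Congruence (m : ℕ) where

  infix 4 _~_

  -- A record rather than a synonym for divisibility, so that `x` and `y` stay recoverable by
  -- unification.
  record _~_ (x y : ℤ) : Set where
    constructor congruent
    field difference : (+ m) Signed.∣ (x ℤ.- y)
  open _~_ public

  ~-via : ∀ {x y z} → (+ m) Signed.∣ z → z ≡ x ℤ.- y → x ~ y
  ~-via d refl = congruent d

  ~-reflexive : ∀ {x y} → x ≡ y → x ~ y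
  ~-reflexive {x} refl = congruent (Signed.divides (+ 0) (ℤ.+-inverseʳ x))

  ~-refl : ∀ {x} → x ~ x
  ~-refl = ~-reflexive refl

  ~-sym : ∀ {x y} → x ~ y → y ~ x
  ~-sym {x} {y} (congruent p) = ~-via (Signed.∣m⇒∣-m p) (lem x y)
    where
    lem : ∀ x y → ℤ.- (x ℤ.- y) ≡ y ℤ.- x
    lem = solve-∀

  ~-trans : ∀ {x y z} → x ~ y → y ~ z → x ~ z
  ~-trans {x} {y} {z} (congruent p) (congruent r) = ~-via (Signed.∣m∣n⇒∣m+n p r) (lem x y z)
    where
    lem : ∀ x y z → (x ℤ.- y) ℤ.+ (y ℤ.- z) ≡ x ℤ.- z
    lem = solve-∀

  ~-+ : ∀ {x y u v} → x ~ y → u ~ v → x ℤ.+ u ~ y ℤ.+ v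
  ~-+ {x} {y} {u} {v} (congruent p) (congruent r) = ~-via (Signed.∣m∣n⇒∣m+n p r) (lem x y u v)
    where
    lem : ∀ x y u v → (x ℤ.- y) ℤ.+ (u ℤ.- v) ≡ (x ℤ.+ u) ℤ.- (y ℤ.+ v)
    lem = solve-∀

  ~-* : ∀ {x y u v} → x ~ y → u ~ v → x ℤ.* u ~ y ℤ.* v
  ~-* {x} {y} {u} {v} (congruent p) (congruent r) =
    ~-via (Signed.∣m∣n⇒∣m+n (Signed.∣n⇒∣m*n u p) (Signed.∣n⇒∣m*n y r)) (lem x y u v)
    where
    lem : ∀ x y u v → u ℤ.* (x ℤ.- y) ℤ.+ y ℤ.* (u ℤ.- v) ≡ x ℤ.* u ℤ.- y ℤ.* v
    lem = solve-∀

  ~-neg : ∀ {x y} → x ~ y → ℤ.- x ~ ℤ.- y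
  ~-neg {x} {y} (congruent p) = ~-via (Signed.∣m⇒∣-m p) (lem x y)
    where
    lem : ∀ x y → ℤ.- (x ℤ.- y) ≡ ℤ.- x ℤ.- ℤ.- y
    lem = solve-∀

  -- A coefficient of degree n of a product involves the factors only up to degree n. This makes
  -- multiplication compatible with truncation, hence well defined modulo q^(M+1).
  ⊛-cong : ∀ {a b c d} n → (∀ k → k ≤ n → a k ~ b k) → (∀ k → k ≤ n → c k ~ d k) →
           (a ⊛ c) n ~ (b ⊛ d) n
  ⊛-cong {a} {b} {c} {d} zero p r =
    ~-trans (~-reflexive (⊛-head a c)) (~-trans (~-* (p 0 z≤n) (r 0 z≤n)) (~-reflexive (sym (⊛-head b d))))
  ⊛-cong {a} {b} {c} {d} (suc n) p r =
    ~-trans (~-reflexive (⊛-tail a c n)) (~-trans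
      (~-+ (~-* (p 0 z≤n) (r (suc n) ℕ.≤-refl))
           (⊛-cong {tail a} {tail b} {c} {d} n (λ k k≤n → p (suc k) (s≤s k≤n)) (λ k k≤n → r k (ℕ.m≤n⇒m≤1+n k≤n))))
      (~-reflexive (sym (⊛-tail b d n))))

  module Truncated (M : ℕ) where

    infix 4 _≋_

    record _≋_ (a b : Series) : Set where
      constructor coefficientwise
      field at : ∀ n → n ≤ M → a n ~ b n
    open _≋_ public

    ≋-reflexive : ∀ {a b} → (∀ n → a n ≡ b n) → a ≋ b
    ≋-reflexive e = coefficientwise (λ n _ → ~-reflexive (e n))

    -- ℤ[[q]] / (m , q^{M+1})
    seriesRing : CommutativeRing 0ℓ 0ℓ
    seriesRing = record
      { Carrier = Series
      ; _≈_ = _≋_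
      ; _+_ = _⊕_
      ; _*_ = _⊛_
      ; -_  = ⊖_
      ; 0#  = const (+ 0)
      ; 1#  = one
      ; isCommutativeRing = record
        { isRing = record
          { +-isAbelianGroup = record
            { isGroup = record
              { isMonoid = record
                { isSemigroup = record
                  { isMagma = record
                    { isEquivalence = record
                      { refl  = ≋-reflexive (λ _ → refl)
                      ; sym   = λ p → coefficientwise (λ n n≤M → ~-sym (at p n n≤M))
                      ; trans = λ p r → coefficientwise (λ n n≤M → ~-trans (at p n n≤M) (at r n n≤M)) }
                    ; ∙-cong = λ p r → coefficientwise (λ n n≤M → ~-+ (at p n n≤M) (at r n n≤M)) }
                  ; assoc = λ a b c → ≋-reflexive (λ n → ℤ.+-assoc (a n) (b n) (c n)) }
                ; identity = (λ a → ≋-reflexive (λ n → trans (cong (ℤ._+ a n) (const-zero n)) (ℤ.+-identityˡ (a n))))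
                           , (λ a → ≋-reflexive (λ n → trans (cong (λ x → a n ℤ.+ x) (const-zero n)) (ℤ.+-identityʳ (a n)))) }
              ; inverse = (λ a → ≋-reflexive (λ n → trans (ℤ.+-inverseˡ (a n)) (sym (const-zero n))))
                        , (λ a → ≋-reflexive (λ n → trans (ℤ.+-inverseʳ (a n)) (sym (const-zero n))))
              ; ⁻¹-cong = λ p → coefficientwise (λ n n≤M → ~-neg (at p n n≤M)) }
            ; comm = λ a b → ≋-reflexive (λ n → ℤ.+-comm (a n) (b n)) }
          ; *-cong = λ {a} {b} {c} {d} p r → coefficientwise (λ n n≤M →
              ⊛-cong {a} {b} {c} {d} n (λ k k≤n → at p k (ℕ.≤-trans k≤n n≤M)) (λ k k≤n → at r k (ℕ.≤-trans k≤n n≤M)))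
          ; *-assoc = λ a b c → ≋-reflexive (⊛-assoc a b c)
          ; *-identity = (λ a → ≋-reflexive (⊛-identityˡ a))
                       , (λ a → ≋-reflexive (λ n → trans (⊛-comm a one n) (⊛-identityˡ a n)))
          ; distrib = (λ c a b → ≋-reflexive (λ n → trans (⊛-comm c (a ⊕ b) n)
                         (trans (⊛-distribʳ c a b n) (cong₂ ℤ._+_ (⊛-comm a c n) (⊛-comm b c n)))))
                    , (λ c a b → ≋-reflexive (⊛-distribʳ c a b)) }
        ; *-comm = λ a b → ≋-reflexive (⊛-comm a b) } }

-- Gauss' identity for theta functions

module IntegerCoefficients {c ℓ} (R : CommutativeRing c ℓ) where

  open CommutativeRing R
    hiding (zero) renaming (refl to ≈-refl; sym to ≈-sym; trans to ≈-trans; reflexive to ≈-reflexive)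
  open Mult semiring using (×-homo-+; ×1-homo-*) renaming (_×_ to _·_)
  open GroupProperties +-group using (ε⁻¹≈ε; ⁻¹-involutive)
  open AbelianGroupProperties +-abelianGroup using (⁻¹-∙-comm)
  open RingProperties ring using (-‿distribˡ-*)
  open SetoidReasoning setoid

  -- The optimised multiples make `ι (+ 1)` and `ι (+ 2)` reduce to `1#` and `1# + 1#`, so that
  -- solver constants agree definitionally with the constants of the goals.
  ι : ℤ → Carrier
  ι (+ n)    = n · 1#
  ι -[1+ n ] = - (suc n · 1#)

  ι-neg : ∀ x → ι (ℤ.- x) ≈ - ι x
  ι-neg (+ zero)  = ≈-sym ε⁻¹≈ε
  ι-neg (+ suc n) = ≈-refl
  ι-neg -[1+ n ]  = ≈-sym (⁻¹-involutive (suc n · 1#))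

  ι-⊖ : ∀ m n → ι (m ℤ.⊖ n) ≈ m · 1# - n · 1#
  ι-⊖ m zero = ≈-sym (≈-trans (+-congˡ ε⁻¹≈ε) (+-identityʳ (m · 1#)))
  ι-⊖ zero (suc n) = ≈-sym (+-identityˡ (- (suc n · 1#)))
  ι-⊖ (suc m) (suc n) = begin
    ι (suc m ℤ.⊖ suc n)               ≡⟨ cong ι (ℤ.[1+m]⊖[1+n]≡m⊖n m n) ⟩
    ι (m ℤ.⊖ n)                       ≈⟨ ι-⊖ m n ⟩
    m · 1# - n · 1#                   ≈⟨ +-congʳ (+-identityʳ (m · 1#)) ⟨
    m · 1# + 0# - n · 1#              ≈⟨ +-congʳ (+-congˡ (-‿inverseʳ 1#)) ⟨
    m · 1# + (1# - 1#) - n · 1#       ≈⟨ +-congʳ (+-assoc _ _ _) ⟨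
    m · 1# + 1# - 1# - n · 1#         ≈⟨ +-assoc _ _ _ ⟩
    m · 1# + 1# + (- 1# - n · 1#)     ≈⟨ +-cong (+-comm _ _) (⁻¹-∙-comm 1# (n · 1#)) ⟩
    1# + m · 1# - (1# + n · 1#)       ≈⟨ +-cong (×-homo-+ 1# 1 m) (-‿cong (×-homo-+ 1# 1 n)) ⟨
    suc m · 1# - suc n · 1#           ∎

  ι-+ : ∀ x y → ι (x ℤ.+ y) ≈ ι x + ι y
  ι-+ (+ m)    (+ n)    = ×-homo-+ 1# m n
  ι-+ (+ m)    -[1+ n ] = ι-⊖ m (suc n)
  ι-+ -[1+ m ] (+ n)    = ≈-trans (ι-⊖ n (suc m)) (+-comm _ _)
  ι-+ -[1+ m ] -[1+ n ] = begin
    - (suc (suc (m ℕ.+ n)) · 1#)         ≡⟨ cong (λ k → - (suc k · 1#)) (ℕ.+-suc m n) ⟨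
    - ((suc m ℕ.+ suc n) · 1#)           ≈⟨ -‿cong (×-homo-+ 1# (suc m) (suc n)) ⟩
    - (suc m · 1# + suc n · 1#)          ≈⟨ ⁻¹-∙-comm _ _ ⟨
    - (suc m · 1#) - suc n · 1#          ∎

  ι-*⁺ : ∀ m y → ι (+ m ℤ.* y) ≈ m · 1# * ι y
  ι-*⁺ m (+ n) = ≈-trans (≈-reflexive (cong ι (sym (ℤ.pos-* m n)))) (×1-homo-* m n)
  ι-*⁺ m -[1+ n ] = begin
    ι (+ m ℤ.* ℤ.- (+ suc n))       ≡⟨ cong ι (ℤ.neg-distribʳ-* (+ m) (+ suc n)) ⟨
    ι (ℤ.- (+ m ℤ.* + suc n))       ≈⟨ ι-neg (+ m ℤ.* + suc n) ⟩
    - ι (+ m ℤ.* + suc n)           ≈⟨ -‿cong (ι-*⁺ m (+ suc n)) ⟩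
    - (m · 1# * (suc n · 1#))       ≈⟨ RingProperties.-‿distribʳ-* ring _ _ ⟩
    m · 1# * - (suc n · 1#)         ∎

  ι-* : ∀ x y → ι (x ℤ.* y) ≈ ι x * ι y
  ι-* (+ m)    y = ι-*⁺ m y
  ι-* -[1+ m ] y = begin
    ι (ℤ.- (+ suc m) ℤ.* y)         ≡⟨ cong ι (ℤ.neg-distribˡ-* (+ suc m) y) ⟨
    ι (ℤ.- (+ suc m ℤ.* y))         ≈⟨ ι-neg (+ suc m ℤ.* y) ⟩
    - ι (+ suc m ℤ.* y)             ≈⟨ -‿cong (ι-*⁺ (suc m) y) ⟩
    - (suc m · 1# * ι y)            ≈⟨ -‿distribˡ-* _ _ ⟩
    - (suc m · 1#) * ι y            ∎

  morphism : ℤ.+-*-rawRing -Raw-AlmostCommutative⟶ fromCommutativeRing R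
  morphism = record
    { ⟦_⟧ = ι ; +-homo = ι-+ ; *-homo = ι-* ; -‿homo = ι-neg ; 0-homo = ≈-refl ; 1-homo = ≈-refl }

  -- Coefficients are compared in ℤ. Relations of the quotient ring, such as 3 = 0 modulo 3, are
  -- therefore invisible to the solver and are applied by hand.
  ι-≟ : ∀ x y → Maybe (ι x ≈ ι y)
  ι-≟ x y with x ℤ.≟ y
  ... | yes x≡y = just (≈-reflexive (cong ι x≡y))
  ... | no  _   = nothing

  module Solver = RingSolver ℤ.+-*-rawRing (fromCommutativeRing R) morphism ι-≟

-- Finite products, truncated theta series and Shanks' identity in a commutative ring

module Theta {c ℓ} (R : CommutativeRing c ℓ) where

  open CommutativeRing R
    hiding (zero) renaming (refl to ≈-refl; sym to ≈-sym; trans to ≈-trans; reflexive to ≈-reflexive)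
  open IntegerCoefficients R using (module Solver)
  open Solver using (solve; _:=_; _:+_; _:*_; _:-_; :-_; con)
  open Exp semiring using (_^_; ^-homo-*; ^-congʳ; ^-congˡ)
  open SetoidReasoning setoid

  2# : Carrier
  2# = 1# + 1#

  sign : ℕ → Carrier
  sign zero    = 1#
  sign (suc n) = - sign n

  -- In q-series notation this is (x; x)_n, and `plusProd x n` is (-x; x)_n.
  minusProd : Carrier → ℕ → Carrier
  minusProd x zero    = 1#
  minusProd x (suc n) = (1# - x ^ suc n) * minusProd x n

  plusProd : Carrier → ℕ → Carrier
  plusProd x zero    = 1#
  plusProd x (suc n) = (1# + x ^ suc n) * plusProd x n

  -- theta x n truncates φ(-x).
  theta : Carrier → ℕ → Carrier
  theta x zero    = 1#
  theta x (suc n) = theta x n + 2# * sign (suc n) * x ^ (suc n ℕ.* suc n)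

  module Shanks (x : Carrier) where

    -- The product of 1 - x^j over s < j ≤ s + r, that is, the quotient (x; x)_(s+r) / (x; x)_s
    -- expressed without division.
    segment : ℕ → ℕ → Carrier
    segment s zero    = 1#
    segment s (suc r) = (1# - x ^ (s ℕ.+ suc r)) * segment s r

    -- The definition releases the top factor; releasing the bottom one lets neighbouring correction
    -- terms be expressed by a common segment.
    segment-first : ∀ s r → segment s (suc r) ≈ (1# - x ^ suc s) * segment (suc s) r
    segment-first s zero = *-congʳ (≈-reflexive (cong (λ k → 1# - x ^ k) (ℕ.+-comm s 1)))
    segment-first s (suc r) = begin
      (1# - x ^ (s ℕ.+ suc (suc r))) * segment s (suc r)
        ≈⟨ *-cong (≈-reflexive (cong (λ k → 1# - x ^ k) (ℕ.+-suc s (suc r)))) (segment-first s r) ⟩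
      (1# - x ^ (suc s ℕ.+ suc r)) * ((1# - x ^ suc s) * segment (suc s) r)
        ≈⟨ solve 3 (λ a b c → a :* (b :* c) := b :* (a :* c)) ≈-refl _ _ _ ⟩
      (1# - x ^ suc s) * ((1# - x ^ (suc s ℕ.+ suc r)) * segment (suc s) r) ∎

    segment-zero : ∀ n → segment 0 n ≈ minusProd x n
    segment-zero zero    = ≈-refl
    segment-zero (suc n) = *-congˡ (segment-zero n)

    -- Shanks' correction terms multiplied by ∏_{j≤n} (1 + x^j), which makes them
    -- polynomial; term n s is the one with index s + 1.
    term : ℕ → ℕ → Carrier
    term n s = 2# * sign (suc s) * x ^ (suc s ℕ.* suc n) * segment (suc s) (n ℕ.∸ suc s) * plusProd x s

    remainder : ℕ → ℕ → Carrier
    remainder n zero    = 0#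
    remainder n (suc k) = remainder n k + term n k

    -- Passing from n to n + 1 multiplies the common denominator by 1 + x^(n+1). Up to this factor
    -- the partial sums agree except for one boundary term, and each further correction term turns
    -- the boundary term for k into the one for k + 1. At k = n the segment in it is empty.
    telescope : ∀ k r n → n ≡ k ℕ.+ r →
      minusProd x (suc n) + remainder (suc n) k
        ≈ (1# + x ^ suc n) * (minusProd x n + remainder n k)
          + 2# * sign (suc k) * x ^ (suc k ℕ.* suc n) * segment k r * plusProd x k
    telescope zero r .r refl = begin
      (1# - x ^ suc r) * minusProd x r + 0#
        ≈⟨ solve 2 (λ a p → (con (+ 1) :- a) :* p :+ con (+ 0) :=
             (con (+ 1) :+ a) :* (p :+ con (+ 0)) :+ con (+ 2) :* :- con (+ 1) :* a :* p :* con (+ 1)) ≈-refl _ _ ⟩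
      (1# + x ^ suc r) * (minusProd x r + 0#) + 2# * - 1# * x ^ suc r * minusProd x r * 1#
        ≈⟨ +-congˡ (*-congʳ (*-cong (*-congˡ (^-congʳ x (sym (ℕ.*-identityˡ (suc r))))) (≈-sym (segment-zero r)))) ⟩
      (1# + x ^ suc r) * (minusProd x r + 0#) + 2# * - 1# * x ^ (1 ℕ.* suc r) * segment 0 r * 1# ∎
    telescope (suc k) r n n≡ = begin
      minusProd x (suc n) + (remainder (suc n) k + term (suc n) k)
        ≈⟨ +-assoc _ _ _ ⟨
      minusProd x (suc n) + remainder (suc n) k + term (suc n) k
        ≈⟨ +-cong (telescope k (suc r) n n≡k+1+r) (*-congʳ (*-cong (*-congˡ exponent₂) segment₂)) ⟩
      (1# + X) * (minusProd x n + remainder n k) + 2# * sign (suc k) * Z * segment k (suc r) * plusProd x k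
        + 2# * sign (suc k) * (Y * Z) * ((1# - X) * segment (suc k) r) * plusProd x k
        ≈⟨ +-congʳ (+-congˡ (*-congʳ (*-congˡ (segment-first k r)))) ⟩
      (1# + X) * (minusProd x n + remainder n k) + 2# * sign (suc k) * Z * ((1# - Y) * segment (suc k) r) * plusProd x k
        + 2# * sign (suc k) * (Y * Z) * ((1# - X) * segment (suc k) r) * plusProd x k
        -- Apart from the common factor 2gZvd and the part (1 + X)e, this is (1 - Y) + Y(1 - X) = 1
        -- - XY = (1 + X) - X(1 + Y).
        ≈⟨ solve 7 (λ X Y Z e g v d →
             (con (+ 1) :+ X) :* e :+ con (+ 2) :* g :* Z :* ((con (+ 1) :- Y) :* v) :* d
               :+ con (+ 2) :* g :* (Y :* Z) :* ((con (+ 1) :- X) :* v) :* d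
             := (con (+ 1) :+ X) :* (e :+ con (+ 2) :* g :* Z :* v :* d)
               :+ con (+ 2) :* :- g :* (X :* Z) :* v :* ((con (+ 1) :+ Y) :* d))
             ≈-refl X Y Z _ _ _ _ ⟩
      (1# + X) * (minusProd x n + remainder n k + 2# * sign (suc k) * Z * segment (suc k) r * plusProd x k)
        + 2# * - sign (suc k) * (X * Z) * segment (suc k) r * ((1# + Y) * plusProd x k)
        ≈⟨ +-cong (*-congˡ (≈-trans (+-assoc _ _ _) (+-congˡ (+-congˡ (*-congʳ (*-congˡ (≈-sym segment₁)))))))
             (*-congʳ (*-congʳ (*-congˡ (≈-sym exponent₁)))) ⟩
      (1# + X) * (minusProd x n + remainder n (suc k))
        + 2# * sign (suc (suc k)) * x ^ (suc (suc k) ℕ.* suc n) * segment (suc k) r * plusProd x (suc k) ∎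
      where
      X = x ^ suc n
      Y = x ^ suc k
      Z = x ^ (suc k ℕ.* suc n)
      n≡k+1+r : n ≡ k ℕ.+ suc r
      n≡k+1+r = trans n≡ (sym (ℕ.+-suc k r))
      exponent₁ : x ^ (suc (suc k) ℕ.* suc n) ≈ X * Z
      exponent₁ = ^-homo-* x (suc n) (suc k ℕ.* suc n)
      exponent₂ : x ^ (suc k ℕ.* suc (suc n)) ≈ Y * Z
      exponent₂ = ≈-trans (^-congʳ x (ℕ.*-suc (suc k) (suc n))) (^-homo-* x (suc k) _)
      segment₁ : segment (suc k) (n ℕ.∸ suc k) ≈ segment (suc k) r
      segment₁ = ≈-reflexive (cong (segment (suc k))
        (trans (cong (ℕ._∸ suc k) n≡) (ℕ.m+n∸m≡n (suc k) r)))
      segment₂ : segment (suc k) (suc n ℕ.∸ suc k) ≈ (1# - X) * segment (suc k) r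
      segment₂ = begin
        segment (suc k) (n ℕ.∸ k)
          ≡⟨ cong (segment (suc k)) (trans (cong (ℕ._∸ k) n≡k+1+r) (ℕ.m+n∸m≡n k (suc r))) ⟩
        (1# - x ^ suc (k ℕ.+ suc r)) * segment (suc k) r
          ≡⟨ cong (λ j → (1# - x ^ suc j) * segment (suc k) r) n≡k+1+r ⟨
        (1# - x ^ suc n) * segment (suc k) r ∎

    shanks : ∀ n → plusProd x n * theta x n ≈ minusProd x n + remainder n n
    shanks zero    = ≈-trans (*-identityˡ 1#) (≈-sym (+-identityʳ 1#))
    shanks (suc n) = begin
      (1# + X) * plusProd x n * (theta x n + 2# * sign (suc n) * Q)
        -- The new theta term times 1 + X splits in two: the summand with Q is the boundary term of
        -- `telescope` at k = n, the one with QX is the newest correction term.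
        ≈⟨ solve 5 (λ X d t g Q → (con (+ 1) :+ X) :* d :* (t :+ con (+ 2) :* g :* Q)
             := (con (+ 1) :+ X) :* (d :* t) :+ con (+ 2) :* g :* Q :* con (+ 1) :* d
                :+ con (+ 2) :* g :* (Q :* X) :* con (+ 1) :* d) ≈-refl X _ _ _ Q ⟩
      (1# + X) * (plusProd x n * theta x n) + 2# * sign (suc n) * Q * 1# * plusProd x n
        + 2# * sign (suc n) * (Q * X) * 1# * plusProd x n
        ≈⟨ +-cong (+-congʳ (*-congˡ (shanks n))) (*-congʳ (*-cong (*-congˡ (≈-sym exponent)) (≈-sym last))) ⟩
      (1# + X) * (minusProd x n + remainder n n) + 2# * sign (suc n) * Q * 1# * plusProd x n + term (suc n) n
        ≈⟨ +-congʳ (telescope n 0 n (sym (ℕ.+-identityʳ n))) ⟨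
      minusProd x (suc n) + remainder (suc n) n + term (suc n) n
        ≈⟨ +-assoc _ _ _ ⟩
      minusProd x (suc n) + remainder (suc n) (suc n) ∎
      where
      X = x ^ suc n
      Q = x ^ (suc n ℕ.* suc n)
      exponent : x ^ (suc n ℕ.* suc (suc n)) ≈ Q * X
      exponent = ≈-trans (≈-trans (^-congʳ x (ℕ.*-suc (suc n) (suc n))) (^-homo-* x (suc n) _)) (*-comm X Q)
      last : segment (suc n) (suc n ℕ.∸ suc n) ≈ 1#
      last = ≈-reflexive (cong (segment (suc n)) (ℕ.n∸n≡0 (suc n)))

    remainder-nilpotent : ∀ n → x ^ suc n ≈ 0# → ∀ k → remainder n k ≈ 0#
    remainder-nilpotent n nil zero    = ≈-refl
    remainder-nilpotent n nil (suc k) = begin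
      remainder n k + 2# * sign (suc k) * x ^ (suc n ℕ.+ k ℕ.* suc n) * segment (suc k) (n ℕ.∸ suc k) * plusProd x k
        ≈⟨ +-cong (remainder-nilpotent n nil k)
             (*-congʳ (*-congʳ (*-congˡ (≈-trans (^-homo-* x (suc n) (k ℕ.* suc n)) (*-congʳ nil))))) ⟩
      0# + 2# * sign (suc k) * (0# * x ^ (k ℕ.* suc n)) * segment (suc k) (n ℕ.∸ suc k) * plusProd x k
        ≈⟨ solve 4 (λ g y v d → con (+ 0) :+ con (+ 2) :* g :* (con (+ 0) :* y) :* v :* d := con (+ 0))
             ≈-refl _ _ _ _ ⟩
      0# ∎

  gauss : ∀ x n → x ^ suc n ≈ 0# → plusProd x n * theta x n ≈ minusProd x n
  gauss x n nil = ≈-trans (shanks n) (≈-trans (+-congˡ (remainder-nilpotent n nil n)) (+-identityʳ _))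
    where open Shanks x

  minusProd-plusProd : ∀ x n → minusProd x n * plusProd x n ≈ minusProd (x * x) n
  minusProd-plusProd x zero    = *-identityˡ 1#
  minusProd-plusProd x (suc n) = begin
    (1# - X) * minusProd x n * ((1# + X) * plusProd x n)
      ≈⟨ solve 3 (λ X e d → (con (+ 1) :- X) :* e :* ((con (+ 1) :+ X) :* d)
           := (con (+ 1) :- X :* X) :* (e :* d)) ≈-refl X _ _ ⟩
    (1# - X * X) * (minusProd x n * plusProd x n)
      ≈⟨ *-cong (+-congˡ (-‿cong (≈-sym (CommutativeExp.^-distrib-* commutativeSemiring x x (suc n)))))
           (minusProd-plusProd x n) ⟩
    (1# - (x * x) ^ suc n) * minusProd (x * x) n ∎
    where X = x ^ suc n

  minusProd-cong : ∀ {x y} n → x ≈ y → minusProd x n ≈ minusProd y n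
  minusProd-cong zero    x≈y = ≈-refl
  minusProd-cong (suc n) x≈y = *-cong (+-congˡ (-‿cong (^-congˡ (suc n) x≈y))) (minusProd-cong n x≈y)

  ^-neg-even : ∀ x m → (- x) ^ (m ℕ.* 2) ≈ x ^ (m ℕ.* 2)
  ^-neg-even x zero    = ≈-refl
  ^-neg-even x (suc m) = begin
    - x * (- x * (- x) ^ (m ℕ.* 2))  ≈⟨ *-congˡ (*-congˡ (^-neg-even x m)) ⟩
    - x * (- x * x ^ (m ℕ.* 2))      ≈⟨ solve 2 (λ x y → :- x :* (:- x :* y) := x :* (x :* y)) ≈-refl x _ ⟩
    x * (x * x ^ (m ℕ.* 2))          ∎

  ^-square : ∀ x m → (x * x) ^ m ≈ x ^ (m ℕ.* 2)
  ^-square x zero    = ≈-refl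
  ^-square x (suc m) = ≈-trans (*-congˡ (^-square x m)) (*-assoc x x _)

  -- For odd j the j-th factor of ∏ (1 - xʲ)/(1 + xʲ) at -x is inverse to that at x.
  sign-pairing : ∀ x m →
    minusProd x (m ℕ.* 2) * minusProd (- x) (m ℕ.* 2) * (plusProd (x * x) m * plusProd (x * x) m)
      ≈ plusProd x (m ℕ.* 2) * plusProd (- x) (m ℕ.* 2) * (minusProd (x * x) m * minusProd (x * x) m)
  sign-pairing x zero    = ≈-refl
  sign-pairing x (suc m) = begin
    (1# - x * X) * ((1# - X) * a) * ((1# - - x * X′) * ((1# - X′) * b)) * ((1# + Y) * d * ((1# + Y) * d))
      ≈⟨ *-cong (*-congˡ (*-cong (+-congˡ (-‿cong (*-congˡ X′≈-X))) (*-congʳ (+-congˡ (-‿cong X′≈-X)))))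
           (*-cong (*-congʳ (+-congˡ Y≈xX)) (*-congʳ (+-congˡ Y≈xX))) ⟩
    (1# - x * X) * ((1# - X) * a) * ((1# - - x * - X) * ((1# - - X) * b)) * ((1# + x * X) * d * ((1# + x * X) * d))
      ≈⟨ solve 5 (λ x X a b d →
           (con (+ 1) :- x :* X) :* ((con (+ 1) :- X) :* a) :* ((con (+ 1) :- :- x :* :- X) :* ((con (+ 1) :- :- X) :* b))
             :* ((con (+ 1) :+ x :* X) :* d :* ((con (+ 1) :+ x :* X) :* d))
           := (con (+ 1) :- x :* X) :* (con (+ 1) :- x :* X) :* (con (+ 1) :- X) :* (con (+ 1) :+ X)
              :* (con (+ 1) :+ x :* X) :* (con (+ 1) :+ x :* X) :* (a :* b :* (d :* d))) ≈-refl x X a b d ⟩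
    (1# - x * X) * (1# - x * X) * (1# - X) * (1# + X) * (1# + x * X) * (1# + x * X) * (a * b * (d * d))
      ≈⟨ *-congˡ (sign-pairing x m) ⟩
    (1# - x * X) * (1# - x * X) * (1# - X) * (1# + X) * (1# + x * X) * (1# + x * X) * (a′ * b′ * (d′ * d′))
      ≈⟨ solve 5 (λ x X a b d →
           (con (+ 1) :- x :* X) :* (con (+ 1) :- x :* X) :* (con (+ 1) :- X) :* (con (+ 1) :+ X)
              :* (con (+ 1) :+ x :* X) :* (con (+ 1) :+ x :* X) :* (a :* b :* (d :* d))
           := (con (+ 1) :+ x :* X) :* ((con (+ 1) :+ X) :* a) :* ((con (+ 1) :+ :- x :* :- X) :* ((con (+ 1) :+ :- X) :* b))
             :* ((con (+ 1) :- x :* X) :* d :* ((con (+ 1) :- x :* X) :* d))) ≈-refl x X a′ b′ d′ ⟩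
    (1# + x * X) * ((1# + X) * a′) * ((1# + - x * - X) * ((1# + - X) * b′)) * ((1# - x * X) * d′ * ((1# - x * X) * d′))
      ≈⟨ *-cong (*-congˡ (*-cong (+-congˡ (*-congˡ X′≈-X)) (*-congʳ (+-congˡ X′≈-X))))
           (*-cong (*-congʳ (+-congˡ (-‿cong Y≈xX))) (*-congʳ (+-congˡ (-‿cong Y≈xX)))) ⟨
    (1# + x * X) * ((1# + X) * a′) * ((1# + - x * X′) * ((1# + X′) * b′)) * ((1# - Y) * d′ * ((1# - Y) * d′)) ∎
    where
    X  = x ^ suc (m ℕ.* 2)
    X′ = (- x) ^ suc (m ℕ.* 2)
    Y  = (x * x) ^ suc m
    a  = minusProd x (m ℕ.* 2)
    b  = minusProd (- x) (m ℕ.* 2)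
    d  = plusProd (x * x) m
    a′ = plusProd x (m ℕ.* 2)
    b′ = plusProd (- x) (m ℕ.* 2)
    d′ = minusProd (x * x) m
    X′≈-X : X′ ≈ - X
    X′≈-X = ≈-trans (*-congˡ (^-neg-even x m)) (solve 2 (λ x y → :- x :* y := :- (x :* y)) ≈-refl x _)
    Y≈xX : Y ≈ x * X
    Y≈xX = ^-square x (suc m)

  *-cancelˡ-unit : ∀ {u v a b} → u * v ≈ 1# → u * a ≈ u * b → a ≈ b
  *-cancelˡ-unit {u} {v} {a} {b} uv ua≈ub = begin
    a            ≈⟨ *-identityˡ a ⟨
    1# * a       ≈⟨ *-congʳ uv ⟨
    u * v * a    ≈⟨ solve 3 (λ u v a → u :* v :* a := v :* (u :* a)) ≈-refl u v a ⟩
    v * (u * a)  ≈⟨ *-congˡ ua≈ub ⟩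
    v * (u * b)  ≈⟨ solve 3 (λ u v b → v :* (u :* b) := u :* v :* b) ≈-refl u v b ⟩
    u * v * b    ≈⟨ *-congʳ uv ⟩
    1# * b       ≈⟨ *-identityˡ b ⟩
    b            ∎

  -- Products and theta sums in q run up to 2m and those in q² up to m, because `sign-pairing`
  -- matches even-indexed factors in q with factors in q². The hypothesis `stable` reconciles the
  -- two lengths for f₂. Below, `φ`, `φ₁`, `φ₂` truncate φ(q), φ(-q), φ(-q²), and primed products
  -- belong to -q.
  module _ (q : Carrier) (m : ℕ) (nilpotent : q ^ suc m ≈ 0#)
           (stable : minusProd (q * q) m ≈ minusProd (q * q) (m ℕ.* 2))
           (g₁ g₂ : Carrier) (inverse₁ : minusProd q (m ℕ.* 2) * g₁ ≈ 1#)
           (inverse₂ : minusProd (q * q) m * g₂ ≈ 1#) where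

    private
      N = m ℕ.* 2
      f₁  = minusProd q N
      f₁′ = minusProd (- q) N
      f₂  = minusProd (q * q) m
      f₄  = minusProd (q * q * (q * q)) m
      d₁  = plusProd q N
      d₁′ = plusProd (- q) N
      d₂  = plusProd (q * q) m
      φ   = theta (- q) N
      φ₁  = theta q N
      φ₂  = theta (q * q) m

    theta₂-inverse : Carrier
    theta₂-inverse = d₂ * g₂

    private
      ^-nilpotent : ∀ x k → x ^ suc m ≈ 0# → x ^ (suc m ℕ.+ k) ≈ 0#
      ^-nilpotent x k nil = ≈-trans (^-homo-* x (suc m) k) (≈-trans (*-congʳ nil) (zeroˡ _))

      nilpotentᴺ : q ^ suc N ≈ 0#
      nilpotentᴺ = ≈-trans (^-congʳ q (cong suc (trans (ℕ.*-comm m 2) (cong (m ℕ.+_) (ℕ.+-identityʳ m)))))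
        (^-nilpotent q m nilpotent)

      nilpotent⁻ : (- q) ^ suc N ≈ 0#
      nilpotent⁻ = ≈-trans (*-congˡ (^-neg-even q m)) (≈-trans
        (solve 2 (λ x y → :- x :* y := :- (con (+ 1)) :* (x :* y)) ≈-refl q _)
        (≈-trans (*-congˡ nilpotentᴺ) (zeroʳ _)))

      nilpotent² : (q * q) ^ suc m ≈ 0#
      nilpotent² = ≈-trans (CommutativeExp.^-distrib-* commutativeSemiring q q (suc m))
        (≈-trans (*-congʳ nilpotent) (zeroˡ _))

      gauss₁ : d₁ * φ₁ ≈ f₁
      gauss₁ = gauss q N nilpotentᴺ

      gauss₁′ : d₁′ * φ ≈ f₁′
      gauss₁′ = gauss (- q) N nilpotent⁻

      gauss₂ : d₂ * φ₂ ≈ f₂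
      gauss₂ = gauss (q * q) m nilpotent²

      f₁d₁ : f₁ * d₁ ≈ f₂
      f₁d₁ = ≈-trans (minusProd-plusProd q N) (≈-sym stable)

      f₁′d₁′ : f₁′ * d₁′ ≈ f₂
      f₁′d₁′ = ≈-trans (minusProd-plusProd (- q) N)
        (≈-trans (minusProd-cong N (solve 1 (λ q → :- q :* :- q := q :* q) ≈-refl q)) (≈-sym stable))

    theta₂-unit : φ₂ * theta₂-inverse ≈ 1#
    theta₂-unit = begin
      φ₂ * (d₂ * g₂)  ≈⟨ solve 3 (λ a b c → a :* (b :* c) := b :* a :* c) ≈-refl φ₂ d₂ g₂ ⟩
      d₂ * φ₂ * g₂    ≈⟨ *-congʳ gauss₂ ⟩
      f₂ * g₂         ≈⟨ inverse₂ ⟩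
      1#              ∎

    -- φ(q) φ(-q) = φ(-q²)²
    theta-product : φ₁ * φ ≈ φ₂ * φ₂
    -- After clearing denominators the claim is `sign-pairing`. The multiplier is a unit because
    -- d₁f₁, d₁′f₁′ and d₂φ₂ all equal f₂, so the complementary factors together with four copies of
    -- g₂ invert it.
    theta-product = *-cancelˡ-unit {d₁ * (d₁′ * (d₂ * d₂))} {f₁ * g₂ * (f₁′ * g₂ * (φ₂ * g₂ * (φ₂ * g₂)))} unit (begin
      d₁ * (d₁′ * (d₂ * d₂)) * (φ₁ * φ)
        ≈⟨ solve 5 (λ a b c s t → a :* (b :* (c :* c)) :* (s :* t)
             := a :* s :* (b :* t) :* (c :* c)) ≈-refl d₁ d₁′ d₂ φ₁ φ ⟩
      d₁ * φ₁ * (d₁′ * φ) * (d₂ * d₂)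
        ≈⟨ *-congʳ (*-cong gauss₁ gauss₁′) ⟩
      f₁ * f₁′ * (d₂ * d₂)
        ≈⟨ sign-pairing q m ⟩
      d₁ * d₁′ * (f₂ * f₂)
        ≈⟨ *-congˡ (*-cong gauss₂ gauss₂) ⟨
      d₁ * d₁′ * (d₂ * φ₂ * (d₂ * φ₂))
        ≈⟨ solve 4 (λ a b c s → a :* b :* (c :* s :* (c :* s))
             := a :* (b :* (c :* c)) :* (s :* s)) ≈-refl d₁ d₁′ d₂ φ₂ ⟩
      d₁ * (d₁′ * (d₂ * d₂)) * (φ₂ * φ₂) ∎)
      where
      unit : d₁ * (d₁′ * (d₂ * d₂)) * (f₁ * g₂ * (f₁′ * g₂ * (φ₂ * g₂ * (φ₂ * g₂)))) ≈ 1#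
      unit = begin
        d₁ * (d₁′ * (d₂ * d₂)) * (f₁ * g₂ * (f₁′ * g₂ * (φ₂ * g₂ * (φ₂ * g₂))))
          ≈⟨ solve 7 (λ a b c f f′ p g → a :* (b :* (c :* c)) :* (f :* g :* (f′ :* g :* (p :* g :* (p :* g))))
               := f :* a :* g :* (f′ :* b :* g :* (c :* p :* g :* (c :* p :* g)))) ≈-refl d₁ d₁′ d₂ f₁ f₁′ φ₂ g₂ ⟩
        f₁ * d₁ * g₂ * (f₁′ * d₁′ * g₂ * (d₂ * φ₂ * g₂ * (d₂ * φ₂ * g₂)))
          ≈⟨ *-cong (*-congʳ f₁d₁) (*-cong (*-congʳ f₁′d₁′) (*-cong (*-congʳ gauss₂) (*-congʳ gauss₂))) ⟩
        f₂ * g₂ * (f₂ * g₂ * (f₂ * g₂ * (f₂ * g₂)))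
          ≈⟨ *-cong inverse₂ (*-cong inverse₂ (*-cong inverse₂ inverse₂)) ⟩
        1# * (1# * (1# * 1#))
          ≈⟨ solve 0 (con (+ 1) :* (con (+ 1) :* (con (+ 1) :* con (+ 1))) := con (+ 1)) ≈-refl ⟩
        1# ∎

    -- By Gauss' identity the left side is 1/φ(-q). Expanding the fraction by φ(q) moves the
    -- denominator to the argument q², where it can merge with the powers of f₄/f₂².
    f₂/f₁² : f₂ * (g₁ * g₁) ≈ φ * (theta₂-inverse * theta₂-inverse)
    f₂/f₁² = begin
      f₂ * (g₁ * g₁)
        ≈⟨ *-identityʳ _ ⟨
      f₂ * (g₁ * g₁) * 1#
        ≈⟨ *-congˡ (≈-trans (*-cong theta₂-unit theta₂-unit) (*-identityˡ 1#)) ⟨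
      f₂ * (g₁ * g₁) * (φ₂ * t * (φ₂ * t))
        ≈⟨ solve 4 (λ f g p t → f :* (g :* g) :* (p :* t :* (p :* t))
             := f :* (p :* p) :* (g :* g) :* (t :* t)) ≈-refl f₂ g₁ φ₂ t ⟩
      f₂ * (φ₂ * φ₂) * (g₁ * g₁) * (t * t)
        ≈⟨ *-congʳ (*-congʳ (*-cong f₁d₁ theta-product)) ⟨
      f₁ * d₁ * (φ₁ * φ) * (g₁ * g₁) * (t * t)
        ≈⟨ solve 6 (λ f d p r g t → f :* d :* (p :* r) :* (g :* g) :* (t :* t)
             := f :* g :* (d :* p :* g) :* (r :* (t :* t))) ≈-refl f₁ d₁ φ₁ φ g₁ t ⟩
      f₁ * g₁ * (d₁ * φ₁ * g₁) * (φ * (t * t))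
        ≈⟨ *-congʳ (*-cong inverse₁ (≈-trans (*-congʳ gauss₁) inverse₁)) ⟩
      1# * 1# * (φ * (t * t))
        ≈⟨ solve 1 (λ a → con (+ 1) :* con (+ 1) :* a := a) ≈-refl _ ⟩
      φ * (t * t) ∎
      where t = theta₂-inverse

    f₄/f₂² : f₄ * (g₂ * g₂) ≈ theta₂-inverse
    f₄/f₂² = begin
      f₄ * (g₂ * g₂)       ≈⟨ *-congʳ (minusProd-plusProd (q * q) m) ⟨
      f₂ * d₂ * (g₂ * g₂)  ≈⟨ solve 3 (λ f d g → f :* d :* (g :* g) := f :* g :* (d :* g)) ≈-refl f₂ d₂ g₂ ⟩
      f₂ * g₂ * (d₂ * g₂)  ≈⟨ *-congʳ inverse₂ ⟩
      1# * (d₂ * g₂)       ≈⟨ *-identityˡ _ ⟩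
      d₂ * g₂              ∎

    -- Here c = k + 2. One inserted factor f₂g₂ = 1 completes the odd power of g₂ to an even one, so
    -- the product regroups as (f₂/f₁²)(f₄/f₂²)^(k+1), and the exponents 2 and k + 1 add up to c +
    -- 1.
    overcubic : ∀ k → f₄ ^ suc k * g₁ ^ 2 * g₂ ^ suc (2 ℕ.* k) ≈ φ * theta₂-inverse ^ (3 ℕ.+ k)
    overcubic k = begin
      f₄ ^ suc k * g₁ ^ 2 * g₂ ^ suc (2 ℕ.* k)
        ≈⟨ *-identityʳ _ ⟨
      f₄ ^ suc k * g₁ ^ 2 * g₂ ^ suc (2 ℕ.* k) * 1#
        ≈⟨ *-cong (*-congˡ (^-congʳ g₂ (cong suc (ℕ.*-comm 2 k)))) (≈-sym inverse₂) ⟩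
      f₄ ^ suc k * (g₁ * (g₁ * 1#)) * (g₂ * g₂ ^ (k ℕ.* 2)) * (f₂ * g₂)
        ≈⟨ solve 5 (λ a g h p f → a :* (g :* (g :* con (+ 1))) :* (h :* p) :* (f :* h)
             := f :* (g :* g) :* (a :* (h :* (h :* p)))) ≈-refl (f₄ ^ suc k) g₁ g₂ _ f₂ ⟩
      f₂ * (g₁ * g₁) * (f₄ ^ suc k * g₂ ^ (suc k ℕ.* 2))
        ≈⟨ *-cong f₂/f₁² (*-congˡ (≈-sym (^-square g₂ (suc k)))) ⟩
      φ * (t * t) * (f₄ ^ suc k * (g₂ * g₂) ^ suc k)
        ≈⟨ *-congˡ (CommutativeExp.^-distrib-* commutativeSemiring f₄ (g₂ * g₂) (suc k)) ⟨
      φ * (t * t) * (f₄ * (g₂ * g₂)) ^ suc k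
        ≈⟨ *-congˡ (^-congˡ (suc k) f₄/f₂²) ⟩
      φ * (t * t) * t ^ suc k
        ≈⟨ solve 3 (λ a b c → a :* (b :* b) :* c := a :* (b :* (b :* c))) ≈-refl φ t _ ⟩
      φ * t ^ (3 ℕ.+ k) ∎
      where t = theta₂-inverse

-- The generating function modulo m and q^{M+1}

shift : Series → Series
shift a zero    = + 0
shift a (suc n) = a n

q : Series
q = shift one

q-⊛ : ∀ a n → (q ⊛ a) n ≡ shift a n
q-⊛ a zero    = trans (⊛-head q a) (ℤ.*-zeroˡ (a 0))
q-⊛ a (suc n) = trans (⊛-tail q a n) (trans
  (cong (ℤ._+ (one ⊛ a) n) (ℤ.*-zeroˡ (a (suc n)))) (trans (ℤ.+-identityˡ _) (⊛-identityˡ a n)))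

pow-q-⊛-low : ∀ k a n → n < k → (pow q k ⊛ a) n ≡ + 0
pow-q-⊛-low (suc k) a zero    _         = trans (⊛-assoc q (pow q k) a 0) (q-⊛ (pow q k ⊛ a) 0)
pow-q-⊛-low (suc k) a (suc n) (s≤s n<k) =
  trans (⊛-assoc q (pow q k) a (suc n)) (trans (q-⊛ (pow q k ⊛ a) (suc n)) (pow-q-⊛-low k a n n<k))

pow-q-⊛-high : ∀ k a n → (pow q k ⊛ a) (k ℕ.+ n) ≡ a n
pow-q-⊛-high zero    a n = ⊛-identityˡ a n
pow-q-⊛-high (suc k) a n =
  trans (⊛-assoc q (pow q k) a (suc k ℕ.+ n)) (trans (q-⊛ (pow q k ⊛ a) (suc k ℕ.+ n)) (pow-q-⊛-high k a n))

pow-q-diagonal : ∀ k → pow q k k ≡ + 1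
pow-q-diagonal zero    = refl
pow-q-diagonal (suc k) = trans (q-⊛ (pow q k) (suc k)) (pow-q-diagonal k)

pow-q-off-diagonal : ∀ k n → n ≢ k → pow q k n ≡ + 0
pow-q-off-diagonal zero    zero    n≢k = contradiction refl n≢k
pow-q-off-diagonal zero    (suc n) n≢k = refl
pow-q-off-diagonal (suc k) zero    n≢k = q-⊛ (pow q k) 0
pow-q-off-diagonal (suc k) (suc n) n≢k =
  trans (q-⊛ (pow q k) (suc n)) (pow-q-off-diagonal k n (n≢k ∘ cong suc))

oneMinus-pow-q : ∀ k n → oneMinus (suc k) n ≡ (one ⊕ ⊖ pow q (suc k)) n
oneMinus-pow-q k zero = cong (λ x → + 1 ℤ.+ ℤ.- x) (sym (q-⊛ (pow q k) 0))
oneMinus-pow-q k (suc n) with suc n ℕ.≟ suc k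
... | yes refl = cong (λ x → + 0 ℤ.+ ℤ.- x) (sym (pow-q-diagonal (suc n)))
... | no  n≢k  = cong (λ x → + 0 ℤ.+ ℤ.- x) (sym (pow-q-off-diagonal (suc k) (suc n) n≢k))

geom-low : ∀ k n → n < k → geom k n ≡ one n
geom-low k zero _ with k ℕ.∣? 0
... | yes _   = refl
... | no  k∤0 = contradiction (k ℕ.∣0) k∤0
geom-low k (suc n) n<k with k ℕ.∣? suc n
... | yes k∣n = contradiction (ℕ.∣⇒≤ k∣n) (ℕ.<⇒≱ n<k)
... | no  _   = refl

geom-period : ∀ k n → geom k (k ℕ.+ n) ≡ geom k n
geom-period k n with k ℕ.∣? (k ℕ.+ n) | k ℕ.∣? n
... | yes _    | yes _   = refl
... | no  _    | no  _   = refl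
... | yes k∣kn | no  k∤n = contradiction (ℕ.∣m+n∣m⇒∣n k∣kn ℕ.∣-refl) k∤n
... | no  k∤kn | yes k∣n = contradiction (ℕ.∣m∣n⇒∣m+n ℕ.∣-refl k∣n) k∤kn

-- Converts the divisibility test in `geom` into a functional equation, from which the invertibility
-- of 1 - q^(k+1) is ring algebra.
geom-recurrence : ∀ k n → geom (suc k) n ≡ (one ⊕ pow q (suc k) ⊛ geom (suc k)) n
geom-recurrence k n with n ℕ.<? suc k
... | yes n<k = trans (geom-low (suc k) n n<k) (trans (sym (ℤ.+-identityʳ (one n)))
                  (cong (λ x → one n ℤ.+ x) (sym (pow-q-⊛-low (suc k) (geom (suc k)) n n<k))))
... | no  n≮k with ℕ.m≤n⇒∃[o]m+o≡n (ℕ.≮⇒≥ n≮k)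
...   | r , refl = trans (geom-period (suc k) r) (trans (sym (pow-q-⊛-high (suc k) (geom (suc k)) r))
                     (sym (ℤ.+-identityˡ _)))

-- The series a(q³). The recursion in steps of three follows `cube-split`, where removing one degree
-- from `a` removes three degrees from its cube.
stretch : Series → Series
stretch a 0 = a 0
stretch a 1 = + 0
stretch a 2 = + 0
stretch a (suc (suc (suc n))) = stretch (tail a) n

stretch-multiple : ∀ a k → stretch a (k ℕ.* 3) ≡ a k
stretch-multiple a zero    = refl
stretch-multiple a (suc k) = stretch-multiple (tail a) k

stretch-cases : ∀ a n → (∃ λ k → n ≡ k ℕ.* 3) ⊎ stretch a n ≡ + 0
stretch-cases a 0 = inj₁ (0 , refl)
stretch-cases a 1 = inj₂ refl
stretch-cases a 2 = inj₂ refl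
stretch-cases a (suc (suc (suc n))) with stretch-cases (tail a) n
... | inj₁ (k , refl) = inj₁ (suc k , refl)
... | inj₂ e          = inj₂ e

-- With c = 2 + d the exponent 3 - 2c is -(2d + 1), visibly negative, so `fPow` selects the power of
-- the inverse.
abar-expand : ∀ d → abar (2 ℕ.+ d) ≡ pow (f 4) (suc d) ⊛ pow (fInv 1) 2 ⊛ pow (fInv 2) (suc (2 ℕ.* d))
abar-expand d = cong (λ e → pow (f 4) (suc d) ⊛ pow (fInv 1) 2 ⊛ fPow 2 (+ 3 ℤ.- e))
  (trans (sym (ℤ.pos-* 2 (2 ℕ.+ d))) (cong +_ (ℕ.*-distribˡ-+ 2 2 d)))

-- Finite checks on residues modulo 9

Sums : List ℕ → List ℕ → List ℕ → Set
Sums S T U = All (λ r → All (λ s → (r ℕ.+ s) % 9 ∈ U) T) S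

-- Inclusions between residue sets are finite statements; instances are settled by evaluation
-- through `from-yes`.
sums? : ∀ S T U → Dec (Sums S T U)
sums? S T U = all? (λ r → all? (λ s → (r ℕ.+ s) % 9 ∈? U) T) S

Triples : List ℕ → List ℕ → Set
Triples S U = All (λ r → r ℕ.* 3 % 9 ∈ U) S

triples? : ∀ S U → Dec (Triples S U)
triples? S U = all? (λ r → r ℕ.* 3 % 9 ∈? U) S

Squares : ℕ → List ℕ → Set
Squares e S = All (λ r → (r ℕ.* r % 9) ℕ.* (e % 9) % 9 ∈ S) (upTo 9)

squares? : ∀ e S → Dec (Squares e S)
squares? e S = all? (λ r → (r ℕ.* r % 9) ℕ.* (e % 9) % 9 ∈? S) (upTo 9)

square-residue : ∀ {S} e n → Squares e S → n ℕ.* n ℕ.* e % 9 ∈ S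
square-residue {S} e n h = subst (_∈ S) (begin
  ((n % 9) ℕ.* (n % 9) % 9) ℕ.* (e % 9) % 9   ≡⟨ cong (λ r → r ℕ.* (e % 9) % 9) (ℕ.%-distribˡ-* n n 9) ⟨
  (n ℕ.* n % 9) ℕ.* (e % 9) % 9               ≡⟨ ℕ.%-distribˡ-* (n ℕ.* n) e 9 ⟨
  n ℕ.* n ℕ.* e % 9                           ∎)
  (All.lookup h (∈-upTo⁺ (ℕ.m%n<n n 9)))
  where open ≡-Reasoning

module Modulo (m M : ℕ) where

  open Congruence m
  open Truncated M
  open CommutativeRing seriesRing
    hiding (zero) renaming (refl to ≈-refl; sym to ≈-sym; trans to ≈-trans; reflexive to ≈-reflexive)
  open Exp semiring using (_^_; ^-congˡ; ^-congʳ; ^-assocʳ)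
  open IntegerCoefficients seriesRing using (module Solver)
  open Solver using (solve; _:=_; _:+_; _:*_; _:-_; :-_; con)
  open Theta seriesRing
  open SetoidReasoning setoid

  pow≡^ : ∀ a k → pow a k ≡ a ^ k
  pow≡^ a zero    = refl
  pow≡^ a (suc k) = cong (a ⊛_) (pow≡^ a k)

  q^-nilpotent : q ^ suc M ≋ 0#
  q^-nilpotent = coefficientwise λ n n≤M → ~-reflexive (trans (cong (λ a → a n) (sym (pow≡^ q (suc M))))
    (trans (pow-q-off-diagonal (suc M) n (ℕ.<⇒≢ (s≤s n≤M))) (sym (const-zero n))))

  oneMinus-≋ : ∀ k → oneMinus (suc k) ≋ 1# + - (q ^ suc k)
  oneMinus-≋ k = ≈-trans (≋-reflexive (oneMinus-pow-q k)) (+-congˡ {one} (-‿cong (≈-reflexive (pow≡^ q (suc k)))))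

  oneMinus-geom : ∀ k → oneMinus (suc k) ⊛ geom (suc k) ≋ one
  oneMinus-geom k = begin
    oneMinus (suc k) * g      ≈⟨ *-congʳ {g} (oneMinus-≋ k) ⟩
    (1# - X) * g              ≈⟨ solve 2 (λ X g → (con (+ 1) :- X) :* g := g :- X :* g) ≈-refl X g ⟩
    g - X * g                 ≈⟨ +-congʳ { - (X * g)} recurrence ⟩
    1# + X * g - X * g        ≈⟨ solve 1 (λ y → con (+ 1) :+ y :- y := con (+ 1)) ≈-refl (X * g) ⟩
    1#                        ∎
    where
    g = geom (suc k)
    X = q ^ suc k
    recurrence : g ≋ 1# + X * g
    recurrence = ≈-trans (≋-reflexive (geom-recurrence k))
      (≈-reflexive (cong (λ p → 1# + p * g) (pow≡^ q (suc k))))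

  -- A factor with index above n is 1 up to degree n. Hence the diagonal definition of `f` and
  -- `fInv` may be replaced by one product of any sufficient length; recursion on `≤′` removes the
  -- surplus factors singly.
  prodUpTo-stable : ∀ F → (∀ j n → n < j → F j n ~ one n) → ∀ {n N} → n ℕ.≤′ N → prodUpTo F N n ~ prodUpTo F n n
  prodUpTo-stable F F≈1 ℕ.≤′-refl = ~-refl
  prodUpTo-stable F F≈1 {n} {suc N} (ℕ.≤′-step n≤N) = ~-trans
    (⊛-cong {F (suc N)} {one} {prodUpTo F N} {prodUpTo F N} n
      (λ k k≤n → F≈1 (suc N) k (s≤s (ℕ.≤-trans k≤n (ℕ.≤′⇒≤ n≤N)))) (λ _ _ → ~-refl))
    (~-trans (~-reflexive (⊛-identityˡ (prodUpTo F N) n)) (prodUpTo-stable F F≈1 n≤N))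

  oneMinus-low : ∀ k j n → n < j → oneMinus (j ℕ.* suc k) n ~ one n
  oneMinus-low k (suc j) n n<j = ~-reflexive (trans (oneMinus-pow-q (k ℕ.+ j ℕ.* suc k) n)
    (trans (cong (λ x → one n ℤ.+ ℤ.- x) (pow-q-off-diagonal (suc j ℕ.* suc k) n
      (ℕ.<⇒≢ (ℕ.<-≤-trans n<j (ℕ.m≤m*n (suc j) (suc k)))))) (ℤ.+-identityʳ (one n))))

  geom-low′ : ∀ k j n → n < j → geom (j ℕ.* suc k) n ~ one n
  geom-low′ k j n n<j = ~-reflexive (geom-low (j ℕ.* suc k) n (ℕ.<-≤-trans n<j (ℕ.m≤m*n j (suc k))))

  prodUpTo-oneMinus : ∀ k N → prodUpTo (λ j → oneMinus (j ℕ.* suc k)) N ≋ minusProd (q ^ suc k) N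
  prodUpTo-oneMinus k zero    = ≈-refl
  prodUpTo-oneMinus k (suc N) = *-cong
    {oneMinus (suc N ℕ.* suc k)} {1# - (q ^ suc k) ^ suc N}
    {prodUpTo (λ j → oneMinus (j ℕ.* suc k)) N} {minusProd (q ^ suc k) N}
    (≈-trans (oneMinus-≋ (k ℕ.+ N ℕ.* suc k)) (+-congˡ {one} (-‿cong (≈-trans
      (^-congʳ q (ℕ.*-comm (suc N) (suc k))) (≈-sym (^-assocʳ q (suc k) (suc N)))))))
    (prodUpTo-oneMinus k N)

  f-≋ : ∀ k {N} → M ≤ N → f (suc k) ≋ minusProd (q ^ suc k) N
  f-≋ k {N} M≤N = ≈-trans
    (coefficientwise λ n n≤M → ~-sym (prodUpTo-stable _ (oneMinus-low k) (ℕ.≤⇒≤′ (ℕ.≤-trans n≤M M≤N))))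
    (prodUpTo-oneMinus k N)

  prodUpTo-inverse : ∀ k N → prodUpTo (λ j → oneMinus (j ℕ.* suc k)) N ⊛ prodUpTo (λ j → geom (j ℕ.* suc k)) N ≋ one
  prodUpTo-inverse k zero    = *-identityˡ 1#
  prodUpTo-inverse k (suc N) = begin
    a * A * (b * B)    ≈⟨ solve 4 (λ a A b B → a :* A :* (b :* B) := a :* b :* (A :* B)) ≈-refl a A b B ⟩
    a * b * (A * B)    ≈⟨ *-cong {a * b} {1#} {A * B} {1#} (oneMinus-geom (k ℕ.+ N ℕ.* suc k)) (prodUpTo-inverse k N) ⟩
    1# * 1#            ≈⟨ *-identityˡ 1# ⟩
    1#                 ∎
    where
    a = oneMinus (suc N ℕ.* suc k)
    b = geom (suc N ℕ.* suc k)
    A = prodUpTo (λ j → oneMinus (j ℕ.* suc k)) N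
    B = prodUpTo (λ j → geom (j ℕ.* suc k)) N

  f-fInv : ∀ k → f (suc k) ⊛ fInv (suc k) ≋ one
  f-fInv k = ≈-trans (*-cong {f (suc k)} {A} {fInv (suc k)} {B}
      (coefficientwise λ n n≤M → ~-sym (prodUpTo-stable _ (oneMinus-low k) (ℕ.≤⇒≤′ n≤M)))
      (coefficientwise λ n n≤M → ~-sym (prodUpTo-stable _ (geom-low′ k) (ℕ.≤⇒≤′ n≤M))))
    (prodUpTo-inverse k M)
    where
    A = prodUpTo (λ j → oneMinus (j ℕ.* suc k)) M
    B = prodUpTo (λ j → geom (j ℕ.* suc k)) M

  private
    f₁-≋ : f 1 ≋ minusProd q (M ℕ.* 2)
    f₁-≋ = ≈-trans (f-≋ 0 (ℕ.m≤m*n M 2)) (minusProd-cong (M ℕ.* 2) (*-identityʳ q))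

    f₂-≋ : ∀ {N} → M ≤ N → f 2 ≋ minusProd (q * q) N
    f₂-≋ {N} M≤N = ≈-trans (f-≋ 1 M≤N) (minusProd-cong N
      (solve 1 (λ x → x :* (x :* con (+ 1)) := x :* x) ≈-refl q))

    f₄-≋ : f 4 ≋ minusProd (q * q * (q * q)) M
    f₄-≋ = ≈-trans (f-≋ 3 ℕ.≤-refl) (minusProd-cong M
      (solve 1 (λ x → x :* (x :* (x :* (x :* con (+ 1)))) := x :* x :* (x :* x)) ≈-refl q))

    stable : minusProd (q * q) M ≋ minusProd (q * q) (M ℕ.* 2)
    stable = ≈-trans (≈-sym (f₂-≋ ℕ.≤-refl)) (f₂-≋ (ℕ.m≤m*n M 2))

    inverse₁ : minusProd q (M ℕ.* 2) * fInv 1 ≋ 1#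
    inverse₁ = ≈-trans (*-congʳ {fInv 1} (≈-sym f₁-≋)) (f-fInv 0)

    inverse₂ : minusProd (q * q) M * fInv 2 ≋ 1#
    inverse₂ = ≈-trans (*-congʳ {fInv 2} (≈-sym (f₂-≋ ℕ.≤-refl))) (f-fInv 1)

  -- φ and φ₂ are truncations of φ(q) and φ(-q²).
  φ φ₂ φ₂⁻¹ : Series
  φ    = theta (- q) (M ℕ.* 2)
  φ₂   = theta (q * q) M
  φ₂⁻¹ = theta₂-inverse q M q^-nilpotent stable (fInv 1) (fInv 2) inverse₁ inverse₂

  φ₂-unit : φ₂ * φ₂⁻¹ ≋ 1#
  φ₂-unit = theta₂-unit q M q^-nilpotent stable (fInv 1) (fInv 2) inverse₁ inverse₂

  abar-φ : ∀ d → abar (2 ℕ.+ d) ≋ φ * φ₂⁻¹ ^ (3 ℕ.+ d)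
  abar-φ d = begin
    abar (2 ℕ.+ d)
      ≡⟨ abar-expand d ⟩
    pow (f 4) (suc d) * pow (fInv 1) 2 * pow (fInv 2) (suc (2 ℕ.* d))
      ≡⟨ cong₂ (λ a b → a * fInv 1 ^ 2 * b) (pow≡^ (f 4) (suc d)) (pow≡^ (fInv 2) (suc (2 ℕ.* d))) ⟩
    f 4 ^ suc d * fInv 1 ^ 2 * fInv 2 ^ suc (2 ℕ.* d)
      ≈⟨ *-congʳ {fInv 2 ^ suc (2 ℕ.* d)} (*-congʳ {fInv 1 ^ 2} (^-congˡ (suc d) f₄-≋)) ⟩
    minusProd (q * q * (q * q)) M ^ suc d * fInv 1 ^ 2 * fInv 2 ^ suc (2 ℕ.* d)
      ≈⟨ overcubic q M q^-nilpotent stable (fInv 1) (fInv 2) inverse₁ inverse₂ d ⟩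
    φ * φ₂⁻¹ ^ (3 ℕ.+ d) ∎

  -- Exponents of non-zero coefficients modulo 9

  ⊛-vanish : ∀ a b n → (∀ i j → i ℕ.+ j ≡ n → a i ~ + 0 ⊎ b j ~ + 0) → (a ⊛ b) n ~ + 0
  ⊛-vanish a b n h = go a b n (λ i j e → product (h i j e))
    where
    product : ∀ {x y} → x ~ + 0 ⊎ y ~ + 0 → x ℤ.* y ~ + 0
    product {x} {y} (inj₁ p) = ~-trans (~-* p ~-refl) (~-reflexive (ℤ.*-zeroˡ y))
    product {x} {y} (inj₂ p) = ~-trans (~-* (~-refl {x}) p) (~-reflexive (ℤ.*-zeroʳ x))
    -- Indexing by pairs with i + j ≡ n gives a hypothesis that survives the passage from `a` to
    -- `tail a`.
    go : ∀ a b n → (∀ i j → i ℕ.+ j ≡ n → a i ℤ.* b j ~ + 0) → (a ⊛ b) n ~ + 0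
    go a b zero    h = ~-trans (~-reflexive (⊛-head a b)) (h 0 0 refl)
    go a b (suc n) h = ~-trans (~-reflexive (⊛-tail a b n))
      (~-+ (h 0 (suc n) refl) (go (tail a) b n (λ i j e → h (suc i) j (cong suc e))))

  -- A disjunction instead of an implication, so that products can be treated by cases on the two
  -- factors.
  Supported : List ℕ → Series → Set
  Supported S a = ∀ n → n ≤ M → n % 9 ∈ S ⊎ a n ~ + 0

  supported-≋ : ∀ {S a b} → a ≋ b → Supported S a → Supported S b
  supported-≋ a≋b p n n≤M with p n n≤M
  ... | inj₁ n∈S = inj₁ n∈S
  ... | inj₂ a~0 = inj₂ (~-trans (~-sym (at a≋b n n≤M)) a~0)

  supported-vanish : ∀ {S a n} → Supported S a → n ≤ M → n % 9 ∉ S → a n ~ + 0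
  supported-vanish {n = n} p n≤M n∉S with p n n≤M
  ... | inj₁ n∈S = contradiction n∈S n∉S
  ... | inj₂ a~0 = a~0

  supported-+ : ∀ {S a b} → Supported S a → Supported S b → Supported S (a + b)
  supported-+ p r n n≤M with p n n≤M | r n n≤M
  ... | inj₁ n∈S | _        = inj₁ n∈S
  ... | inj₂ _   | inj₁ n∈S = inj₁ n∈S
  ... | inj₂ a~0 | inj₂ b~0 = inj₂ (~-+ a~0 b~0)

  supported-neg : ∀ {S a} → Supported S a → Supported S (- a)
  supported-neg p n n≤M with p n n≤M
  ... | inj₁ n∈S = inj₁ n∈S
  ... | inj₂ a~0 = inj₂ (~-neg a~0)

  supported-⊆ : ∀ {S T a} → (∀ {r} → r ∈ S → r ∈ T) → Supported S a → Supported T a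
  supported-⊆ S⊆T p n n≤M with p n n≤M
  ... | inj₁ n∈S = inj₁ (S⊆T n∈S)
  ... | inj₂ a~0 = inj₂ a~0

  supported-* : ∀ {S T a b} U → Sums S T U →
                Supported S a → Supported T b → Supported U (a * b)
  supported-* {S} {T} {a} {b} U S+T⊆U p r n n≤M with (n % 9) ∈? U
  ... | yes n∈U = inj₁ n∈U
  ... | no  n∉U = inj₂ (⊛-vanish a b n factor)
    where
    factor : ∀ i j → i ℕ.+ j ≡ n → a i ~ + 0 ⊎ b j ~ + 0
    factor i j refl with p i (ℕ.≤-trans (ℕ.m≤m+n i j) n≤M) | r j (ℕ.≤-trans (ℕ.m≤n+m j i) n≤M)
    ... | inj₂ a~0 | _        = inj₁ a~0
    ... | inj₁ _   | inj₂ b~0 = inj₂ b~0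
    ... | inj₁ i∈S | inj₁ j∈T = contradiction
      (subst (_∈ U) (sym (ℕ.%-distribˡ-+ i j 9)) (All.lookup (All.lookup S+T⊆U i∈S) j∈T)) n∉U

  supported-one : Supported (0 ∷ []) one
  supported-one zero    _ = inj₁ (here refl)
  supported-one (suc n) _ = inj₂ ~-refl

  supported-sign : ∀ n → Supported (0 ∷ []) (sign n)
  supported-sign zero    = supported-one
  supported-sign (suc n) = supported-neg (supported-sign n)

  supported-q : Supported (1 ∷ []) q
  supported-q zero          _ = inj₂ ~-refl
  supported-q (suc zero)    _ = inj₁ (here refl)
  supported-q (suc (suc n)) _ = inj₂ ~-refl

  supported-^ : ∀ {e a} → Supported (e % 9 ∷ []) a → ∀ k → Supported (k ℕ.* e % 9 ∷ []) (a ^ k)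
  supported-^ p zero    = supported-one
  supported-^ {e} {a} p (suc k) = supported-* (suc k ℕ.* e % 9 ∷ [])
    ((here (sym (ℕ.%-distribˡ-+ e (k ℕ.* e) 9)) All.∷ All.[]) All.∷ All.[]) p (supported-^ {e} p k)

  -- The support is recorded for u, not only for 1 + 2u: modulo 4 a product has u-part u + v, so
  -- supports are united instead of added residue by residue.
  Unipotent : List ℕ → Series → Set
  Unipotent S a = ∃ λ u → a ≋ 1# + 2# * u × Supported S u

  unipotent-one : ∀ {S} → Unipotent S 1#
  unipotent-one = const (+ 0) , solve 0 (con (+ 1) := con (+ 1) :+ con (+ 2) :* con (+ 0)) ≈-refl ,
    λ n _ → inj₂ (~-reflexive (const-zero n))

  theta-unipotent : ∀ {S e x} → Supported (e % 9 ∷ []) x → Squares e S →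
                ∀ n → Unipotent S (theta x n)
  theta-unipotent p sq zero = unipotent-one
  theta-unipotent {S} {e} {x} p sq (suc n) with theta-unipotent {S} {e} {x} p sq n
  ... | u , shape , supported = u + sign (suc n) * x ^ (suc n ℕ.* suc n) ,
    ≈-trans (+-congʳ {2# * sign (suc n) * x ^ (suc n ℕ.* suc n)} shape)
      (solve 3 (λ u g y → con (+ 1) :+ con (+ 2) :* u :+ con (+ 2) :* g :* y := con (+ 1) :+ con (+ 2) :* (u :+ g :* y))
        ≈-refl u (sign (suc n)) (x ^ (suc n ℕ.* suc n))) ,
    supported-+ supported (supported-* S ((residue All.∷ All.[]) All.∷ All.[])
      (supported-sign (suc n)) (supported-^ {e} {x} p (suc n ℕ.* suc n)))
    where
    residue : (suc n ℕ.* suc n ℕ.* e % 9) % 9 ∈ S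
    residue = subst (_∈ S) (sym (ℕ.m%n%n≡m%n (suc n ℕ.* suc n ℕ.* e) 9)) (square-residue e (suc n) sq)

  φ-unipotent : Unipotent (0 ∷ 1 ∷ 4 ∷ 7 ∷ []) φ
  φ-unipotent = theta-unipotent {e = 1} {x = - q} (supported-neg supported-q) (from-yes (squares? 1 (0 ∷ 1 ∷ 4 ∷ 7 ∷ []))) (M ℕ.* 2)

  φ₂-unipotent : Unipotent (0 ∷ 2 ∷ 5 ∷ 8 ∷ []) φ₂
  φ₂-unipotent = theta-unipotent {e = 2} {x = q * q}
    (supported-* {a = q} {b = q} (2 ∷ []) (from-yes (sums? (1 ∷ []) (1 ∷ []) (2 ∷ []))) supported-q supported-q)
    (from-yes (squares? 2 (0 ∷ 2 ∷ 5 ∷ 8 ∷ []))) M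

  unipotent-supported : ∀ {S a} → 0 ∈ S → Unipotent S a → Supported S a
  -- The constant term 1 requires 0 ∈ S; writing 2u as u + u reduces the rest to sums.
  unipotent-supported {S} {a} 0∈S (u , shape , supported) = supported-≋ {S} {1# + (u + u)} {a}
    (≈-trans (solve 1 (λ u → con (+ 1) :+ (u :+ u) := con (+ 1) :+ con (+ 2) :* u) ≈-refl u) (≈-sym shape))
    (supported-+ {S} {1#} {u + u} (supported-⊆ (λ { (here refl) → 0∈S }) supported-one)
      (supported-+ {S} {u} {u} supported supported))

  φ-supported : Supported (0 ∷ 1 ∷ 4 ∷ 7 ∷ []) φ
  φ-supported = unipotent-supported (here refl) φ-unipotent

  φ₂-supported : Supported (0 ∷ 2 ∷ 5 ∷ 8 ∷ []) φ₂
  φ₂-supported = unipotent-supported (here refl) φ₂-unipotent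

-- The congruences modulo 3, 4 and 2

~0⇒∣ : ∀ {m x} → Congruence._~_ m x (+ 0) → m ℕ.∣ ℤ.∣ x ∣
~0⇒∣ {m} {x} p = Signed.∣⇒∣ᵤ (subst (+ m Signed.∣_) (ℤ.+-identityʳ x) (Congruence._~_.difference p))

fermat₃ : ∀ x → Congruence._~_ 3 (x ℤ.* (x ℤ.* (x ℤ.* + 1))) x
fermat₃ x = ~-trans (~-* x~r (~-* x~r (~-* x~r ~-refl))) (~-trans (cube (x ℤ.%ℕ 3) (ℤ.n%ℕd<d x 3)) (~-sym x~r))
  where
  open Congruence 3
  x~r : x ~ + (x ℤ.%ℕ 3)
  x~r = congruent (Signed.divides (x ℤ./ℕ 3)
    (trans (cong (ℤ._- + (x ℤ.%ℕ 3)) (ℤ.a≡a%ℕn+[a/ℕn]*n x 3)) (lem (+ (x ℤ.%ℕ 3)) (x ℤ./ℕ 3 ℤ.* + 3))))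
    where
    lem : ∀ r y → r ℤ.+ y ℤ.- r ≡ y
    lem = solve-∀
  cube : ∀ r → r < 3 → + r ℤ.* (+ r ℤ.* (+ r ℤ.* + 1)) ~ + r
  cube 0 _ = ~-refl
  cube 1 _ = ~-refl
  cube 2 _ = congruent (Signed.divides (+ 2) refl)
  cube (suc (suc (suc _))) (s≤s (s≤s (s≤s ())))

-- Cubing modulo 3

module Cubes (M : ℕ) where

  open Congruence 3
  open Truncated M
  open CommutativeRing seriesRing
    hiding (zero) renaming (refl to ≈-refl; sym to ≈-sym; trans to ≈-trans; reflexive to ≈-reflexive)
  open IntegerCoefficients seriesRing using (module Solver)
  open Solver using (solve; _:=_; _:+_; _:*_; con)
  open SetoidReasoning setoid

  split-head : ∀ a → a ≋ const (a 0) + q * tail a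
  split-head a = ≋-reflexive λ
    { zero    → sym (trans (cong (λ x → a 0 ℤ.+ x) (q-⊛ (tail a) 0)) (ℤ.+-identityʳ (a 0)))
    ; (suc n) → sym (trans (ℤ.+-identityˡ _) (q-⊛ (tail a) (suc n))) }

  3≋0 : 1# + 1# + 1# ≋ 0#
  3≋0 = coefficientwise λ { zero _ → congruent (Signed.divides (+ 1) refl) ; (suc _) _ → ~-refl }

  -- Frobenius applied to a = a(0) + q · tail a: the mixed terms of the cube carry a factor 3.
  cube-split : ∀ a → pow a 3 ≋ pow (const (a 0)) 3 + pow q 3 * pow (tail a) 3
  cube-split a = begin
    pow a 3
      ≈⟨ *-cong {a} {s} (split-head a) (*-cong {a} {s} (split-head a) (*-congʳ {1#} (split-head a))) ⟩
    pow s 3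
      ≈⟨ solve 3 (λ c x t →
           (c :+ x :* t) :* ((c :+ x :* t) :* ((c :+ x :* t) :* con (+ 1)))
           := c :* (c :* (c :* con (+ 1))) :+ x :* (x :* (x :* con (+ 1))) :* (t :* (t :* (t :* con (+ 1))))
              :+ con (+ 3) :* (c :* c :* (x :* t) :+ c :* (x :* t) :* (x :* t)))
         ≈-refl c q t ⟩
    pow c 3 + pow q 3 * pow t 3 + (1# + 1# + 1#) * r
      ≈⟨ +-congˡ {pow c 3 + pow q 3 * pow t 3} (≈-trans (*-congʳ {r} 3≋0) (zeroˡ r)) ⟩
    pow c 3 + pow q 3 * pow t 3 + 0#
      ≈⟨ +-identityʳ (pow c 3 + pow q 3 * pow t 3) ⟩
    pow c 3 + pow q 3 * pow t 3 ∎
    where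
    c = const (a 0)
    t = tail a
    s = c + q * t
    r = c * c * (q * t) + c * (q * t) * (q * t)

const-cube : ∀ k n → pow (const k) 3 n ≡ k ℤ.* (k ℤ.* (k ℤ.* one n))
const-cube k n = trans (const-⊛ k (pow (const k) 2) n) (cong (k ℤ.*_)
  (trans (const-⊛ k (pow (const k) 1) n) (cong (k ℤ.*_) (const-⊛ k one n))))

const-cube-suc : ∀ k n → pow (const k) 3 (suc n) ≡ + 0
const-cube-suc k n = trans (const-cube k (suc n))
  (trans (cong (λ x → k ℤ.* (k ℤ.* x)) (ℤ.*-zeroʳ k)) (trans (cong (k ℤ.*_) (ℤ.*-zeroʳ k)) (ℤ.*-zeroʳ k)))

-- Iterates `cube-split`: Fermat turns a(0)³ into a(0), and q³ (tail a)³ in degree n + 3 is (tail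
-- a)³ in degree n. Each round uses its own degree as truncation bound.
cube-stretch : ∀ n a → Congruence._~_ 3 (pow a 3 n) (stretch a n)
cube-stretch n a = ~-trans (Truncated.at (Cubes.cube-split n a) n ℕ.≤-refl) (compare n a)
  where
  open Congruence 3
  compare : ∀ n a → (pow (const (a 0)) 3 ⊕ pow q 3 ⊛ pow (tail a) 3) n ~ stretch a n
  compare 0 a = ~-trans (~-+ (~-trans (~-reflexive (const-cube (a 0) 0)) (fermat₃ (a 0)))
    (~-reflexive (pow-q-⊛-low 3 (pow (tail a) 3) 0 (s≤s z≤n)))) (~-reflexive (ℤ.+-identityʳ (a 0)))
  compare 1 a = ~-reflexive (cong₂ ℤ._+_ (const-cube-suc (a 0) 0)
    (pow-q-⊛-low 3 (pow (tail a) 3) 1 (s≤s (s≤s z≤n))))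
  compare 2 a = ~-reflexive (cong₂ ℤ._+_ (const-cube-suc (a 0) 1)
    (pow-q-⊛-low 3 (pow (tail a) 3) 2 (s≤s (s≤s (s≤s z≤n)))))
  compare (suc (suc (suc n))) a = ~-trans
    (~-reflexive (trans (cong₂ ℤ._+_ (const-cube-suc (a 0) (2 ℕ.+ n)) (pow-q-⊛-high 3 (pow (tail a) 3) n))
      (ℤ.+-identityˡ _)))
    (cube-stretch n (tail a))

-- The generating function modulo 3

module Modulo3 (M : ℕ) where

  open Modulo 3 M
  open Congruence 3
  open Truncated M
  open CommutativeRing seriesRing
    hiding (zero) renaming (refl to ≈-refl; sym to ≈-sym; trans to ≈-trans; reflexive to ≈-reflexive)
  open Exp semiring using (_^_; ^-congˡ; ^-congʳ; ^-homo-*; ^-assocʳ)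
  open IntegerCoefficients seriesRing using (module Solver)
  open Solver using (solve; _:=_; _:*_; con)
  open SetoidReasoning setoid

  -- Since a³ is a(q³) modulo 3, residues are tripled; the general product rule would only give sums
  -- of three of them.
  supported-cube : ∀ {S a} U → Triples S U → Supported S a → Supported U (a ^ 3)
  supported-cube {S} {a} U S³⊆U p n n≤M with stretch-cases a n
  ... | inj₂ e = inj₂ (~-trans (cube-stretch n a) (~-reflexive e))
  ... | inj₁ (k , refl) with p k (ℕ.≤-trans (ℕ.m≤m*n k 3) n≤M)
  ...   | inj₁ k∈S = inj₁ (subst (_∈ U) (sym (ℕ.%-distribˡ-* k 3 9)) (All.lookup S³⊆U k∈S))
  ...   | inj₂ a~0 = inj₂ (~-trans (cube-stretch n a) (~-trans (~-reflexive (stretch-multiple a k)) a~0))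

  supported-all : ∀ a → Supported (upTo 9) a
  supported-all a n _ = inj₁ (∈-upTo⁺ (ℕ.m%n<n n 9))

  -- Valid for every series, which is how powers of `φ₂⁻¹` are handled without knowing its
  -- coefficients.
  cube-supported : ∀ a → Supported (0 ∷ 3 ∷ 6 ∷ []) (a ^ 3)
  cube-supported a = supported-cube {a = a} (0 ∷ 3 ∷ 6 ∷ []) (from-yes (triples? (upTo 9) (0 ∷ 3 ∷ 6 ∷ []))) (supported-all a)

  ninth-power-supported : ∀ a → Supported (0 ∷ []) ((a ^ 3) ^ 3)
  ninth-power-supported a = supported-cube {a = a ^ 3} (0 ∷ []) (from-yes (triples? (0 ∷ 3 ∷ 6 ∷ []) (0 ∷ []))) (cube-supported a)

  -- Here c + 1 = 3(i + 1), so the exponents are k² plus multiples of 3, and the list consists of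
  -- the classes 0 and 1 modulo 3.
  abar-3i+2-supported : ∀ i → Supported (0 ∷ 1 ∷ 3 ∷ 4 ∷ 6 ∷ 7 ∷ []) (abar (2 ℕ.+ 3 ℕ.* i))
  abar-3i+2-supported i = supported-≋ {a = φ * (φ₂⁻¹ ^ suc i) ^ 3} (≈-sym factor)
    (supported-* {a = φ} {b = (φ₂⁻¹ ^ suc i) ^ 3} (0 ∷ 1 ∷ 3 ∷ 4 ∷ 6 ∷ 7 ∷ [])
      (from-yes (sums? (0 ∷ 1 ∷ 4 ∷ 7 ∷ []) (0 ∷ 3 ∷ 6 ∷ []) (0 ∷ 1 ∷ 3 ∷ 4 ∷ 6 ∷ 7 ∷ [])))
      φ-supported (cube-supported (φ₂⁻¹ ^ suc i)))
    where
    factor : abar (2 ℕ.+ 3 ℕ.* i) ≋ φ * (φ₂⁻¹ ^ suc i) ^ 3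
    factor = ≈-trans (abar-φ (3 ℕ.* i)) (*-congˡ {φ} (≈-trans
      (^-congʳ φ₂⁻¹ (trans (sym (ℕ.*-suc 3 i)) (ℕ.*-comm 3 (suc i)))) (≈-sym (^-assocʳ φ₂⁻¹ (suc i) 3))))

  φ₂⁻¹-ninth : ∀ i → φ₂⁻¹ ^ (9 ℕ.+ 9 ℕ.* i) ≋ ((φ₂⁻¹ ^ suc i) ^ 3) ^ 3
  φ₂⁻¹-ninth i = begin
    φ₂⁻¹ ^ (9 ℕ.+ 9 ℕ.* i)        ≈⟨ ^-congʳ φ₂⁻¹ (trans (sym (ℕ.*-suc 9 i)) (trans (ℕ.*-comm 9 (suc i)) (sym (ℕ.*-assoc (suc i) 3 3)))) ⟩
    φ₂⁻¹ ^ (suc i ℕ.* 3 ℕ.* 3)    ≈⟨ ^-assocʳ φ₂⁻¹ (suc i ℕ.* 3) 3 ⟨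
    (φ₂⁻¹ ^ (suc i ℕ.* 3)) ^ 3    ≈⟨ ^-congˡ 3 (^-assocʳ φ₂⁻¹ (suc i) 3) ⟨
    ((φ₂⁻¹ ^ suc i) ^ 3) ^ 3      ∎

  abar-9i+8-supported : ∀ i → Supported (0 ∷ 1 ∷ 4 ∷ 7 ∷ []) (abar (8 ℕ.+ 9 ℕ.* i))
  abar-9i+8-supported i = supported-≋ {a = φ * ((φ₂⁻¹ ^ suc i) ^ 3) ^ 3}
    (≈-sym (≈-trans (abar-φ (6 ℕ.+ 9 ℕ.* i)) (*-congˡ {φ} (φ₂⁻¹-ninth i))))
    (supported-* {a = φ} {b = ((φ₂⁻¹ ^ suc i) ^ 3) ^ 3} (0 ∷ 1 ∷ 4 ∷ 7 ∷ [])
      (from-yes (sums? (0 ∷ 1 ∷ 4 ∷ 7 ∷ []) (0 ∷ []) (0 ∷ 1 ∷ 4 ∷ 7 ∷ [])))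
      φ-supported (ninth-power-supported (φ₂⁻¹ ^ suc i)))

  -- Here c + 1 = 9(i + 1) - 3. Expanding by φ(-q²)³ completes the denominator to a ninth power; the
  -- new numerator has exponents 6l², which are 0 or 6 modulo 9.
  abar-9i+5-supported : ∀ i → Supported (0 ∷ 1 ∷ 4 ∷ 6 ∷ 7 ∷ []) (abar (5 ℕ.+ 9 ℕ.* i))
  abar-9i+5-supported i = supported-≋ {a = φ * φ₂ ^ 3 * ((φ₂⁻¹ ^ suc i) ^ 3) ^ 3} (≈-sym factor)
    (supported-* {a = φ * φ₂ ^ 3} {b = ((φ₂⁻¹ ^ suc i) ^ 3) ^ 3} (0 ∷ 1 ∷ 4 ∷ 6 ∷ 7 ∷ [])
      (from-yes (sums? (0 ∷ 1 ∷ 4 ∷ 6 ∷ 7 ∷ []) (0 ∷ []) (0 ∷ 1 ∷ 4 ∷ 6 ∷ 7 ∷ [])))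
      (supported-* {a = φ} {b = φ₂ ^ 3} (0 ∷ 1 ∷ 4 ∷ 6 ∷ 7 ∷ [])
        (from-yes (sums? (0 ∷ 1 ∷ 4 ∷ 7 ∷ []) (0 ∷ 6 ∷ []) (0 ∷ 1 ∷ 4 ∷ 6 ∷ 7 ∷ []))) φ-supported
        (supported-cube {a = φ₂} (0 ∷ 6 ∷ []) (from-yes (triples? (0 ∷ 2 ∷ 5 ∷ 8 ∷ []) (0 ∷ 6 ∷ []))) φ₂-supported))
      (ninth-power-supported (φ₂⁻¹ ^ suc i)))
    where
    cancel : φ₂ ^ 3 * φ₂⁻¹ ^ 3 ≋ 1#
    cancel = begin
      φ₂ ^ 3 * φ₂⁻¹ ^ 3      ≈⟨ CommutativeExp.^-distrib-* commutativeSemiring φ₂ φ₂⁻¹ 3 ⟨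
      (φ₂ * φ₂⁻¹) ^ 3        ≈⟨ ^-congˡ 3 φ₂-unit ⟩
      1# ^ 3                 ≈⟨ solve 0 (con (+ 1) :* (con (+ 1) :* (con (+ 1) :* con (+ 1))) := con (+ 1)) ≈-refl ⟩
      1#                     ∎
    factor : abar (5 ℕ.+ 9 ℕ.* i) ≋ φ * φ₂ ^ 3 * ((φ₂⁻¹ ^ suc i) ^ 3) ^ 3
    factor = begin
      abar (5 ℕ.+ 9 ℕ.* i)
        ≈⟨ abar-φ (3 ℕ.+ 9 ℕ.* i) ⟩
      φ * t
        ≈⟨ *-congʳ {t} (≈-trans (*-congˡ {φ} cancel) (*-identityʳ φ)) ⟨
      φ * (φ₂ ^ 3 * φ₂⁻¹ ^ 3) * t
        ≈⟨ solve 4 (λ a b c d → a :* (b :* c) :* d := a :* b :* (c :* d)) ≈-refl φ (φ₂ ^ 3) (φ₂⁻¹ ^ 3) t ⟩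
      φ * φ₂ ^ 3 * (φ₂⁻¹ ^ 3 * t)
        ≈⟨ *-congˡ {φ * φ₂ ^ 3} (≈-trans (≈-sym (^-homo-* φ₂⁻¹ 3 (6 ℕ.+ 9 ℕ.* i))) (φ₂⁻¹-ninth i)) ⟩
      φ * φ₂ ^ 3 * ((φ₂⁻¹ ^ suc i) ^ 3) ^ 3 ∎
      where t = φ₂⁻¹ ^ (6 ℕ.+ 9 ℕ.* i)

-- The generating function modulo 4

module Modulo4 (M : ℕ) where

  open Modulo 4 M
  open Congruence 4
  open Truncated M
  open CommutativeRing seriesRing
    hiding (zero) renaming (refl to ≈-refl; sym to ≈-sym; trans to ≈-trans; reflexive to ≈-reflexive)
  open Theta seriesRing using (2#)
  open Exp semiring using (_^_; ^-congˡ)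
  open IntegerCoefficients seriesRing using (module Solver)
  open Solver using (solve; _:=_; _:+_; _:*_; con)
  open SetoidReasoning setoid

  4≋0 : 2# + 1# + 1# ≋ 0#
  4≋0 = coefficientwise λ { zero _ → congruent (Signed.divides (+ 1) refl) ; (suc _) _ → ~-refl }

  unipotent-* : ∀ {S a b} → Unipotent S a → Unipotent S b → Unipotent S (a * b)
  unipotent-* {S} {a} {b} (u , a≋ , u∈S) (v , b≋ , v∈S) = u + v , (begin
    a * b
      ≈⟨ *-cong {a} {1# + 2# * u} {b} {1# + 2# * v} a≋ b≋ ⟩
    (1# + 2# * u) * (1# + 2# * v)
      ≈⟨ solve 2 (λ u v → (con (+ 1) :+ con (+ 2) :* u) :* (con (+ 1) :+ con (+ 2) :* v)
           := con (+ 1) :+ con (+ 2) :* (u :+ v) :+ con (+ 4) :* (u :* v)) ≈-refl u v ⟩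
    1# + 2# * (u + v) + (2# + 1# + 1#) * (u * v)
      ≈⟨ +-congˡ {1# + 2# * (u + v)} (≈-trans (*-congʳ {u * v} 4≋0) (zeroˡ (u * v))) ⟩
    1# + 2# * (u + v) + 0#
      ≈⟨ +-identityʳ (1# + 2# * (u + v)) ⟩
    1# + 2# * (u + v) ∎) , supported-+ u∈S v∈S

  unipotent-^ : ∀ {S a} → Unipotent S a → ∀ k → Unipotent S (a ^ k)
  unipotent-^ p zero    = unipotent-one
  unipotent-^ p (suc k) = unipotent-* p (unipotent-^ p k)

  unipotent-⊆ : ∀ {S T a} → (∀ {r} → r ∈ S → r ∈ T) → Unipotent S a → Unipotent T a
  unipotent-⊆ S⊆T (u , a≋ , u∈S) = u , a≋ , supported-⊆ S⊆T u∈S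

  unipotent-square : ∀ {S a} → Unipotent S a → a * a ≋ 1#
  unipotent-square {a = a} (u , a≋ , _) = begin
    a * a
      ≈⟨ *-cong {a} {1# + 2# * u} {a} {1# + 2# * u} a≋ a≋ ⟩
    (1# + 2# * u) * (1# + 2# * u)
      ≈⟨ solve 1 (λ u → (con (+ 1) :+ con (+ 2) :* u) :* (con (+ 1) :+ con (+ 2) :* u)
           := con (+ 1) :+ con (+ 4) :* (u :+ u :* u)) ≈-refl u ⟩
    1# + (2# + 1# + 1#) * (u + u * u)
      ≈⟨ +-congˡ {1#} (≈-trans (*-congʳ {u + u * u} 4≋0) (zeroˡ (u + u * u))) ⟩
    1# + 0#
      ≈⟨ +-identityʳ 1# ⟩
    1# ∎

  -- Having square 1, `φ₂` is its own inverse. The denominator thus becomes a positive power of a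
  -- series with known support.
  φ₂⁻¹≋φ₂ : φ₂⁻¹ ≋ φ₂
  φ₂⁻¹≋φ₂ = begin
    φ₂⁻¹                ≈⟨ *-identityˡ φ₂⁻¹ ⟨
    1# * φ₂⁻¹           ≈⟨ *-congʳ {φ₂⁻¹} (unipotent-square φ₂-unipotent) ⟨
    φ₂ * φ₂ * φ₂⁻¹      ≈⟨ solve 2 (λ a b → a :* a :* b := a :* b :* a) ≈-refl φ₂ φ₂⁻¹ ⟩
    φ₂ * φ₂⁻¹ * φ₂      ≈⟨ *-congʳ {φ₂} φ₂-unit ⟩
    1# * φ₂             ≈⟨ *-identityˡ φ₂ ⟩
    φ₂                  ∎

  -- The residues modulo 9 of k² and 2k².
  thetaResidues : List ℕ
  thetaResidues = 0 ∷ 1 ∷ 2 ∷ 4 ∷ 5 ∷ 7 ∷ 8 ∷ []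

  abar-supported : ∀ d → Supported thetaResidues (abar (2 ℕ.+ d))
  abar-supported d = supported-≋ (≈-sym (abar-φ d)) (supported-≋ (*-congˡ {φ} (≈-sym (^-congˡ (3 ℕ.+ d) φ₂⁻¹≋φ₂)))
    (unipotent-supported (here refl) unipotent))
    where
    unipotent : Unipotent thetaResidues (φ * φ₂ ^ (3 ℕ.+ d))
    unipotent = unipotent-*
      (unipotent-⊆ (All.lookup (from-yes (all? (_∈? thetaResidues) (0 ∷ 1 ∷ 4 ∷ 7 ∷ [])))) φ-unipotent)
      (unipotent-^ (unipotent-⊆ (All.lookup (from-yes (all? (_∈? thetaResidues) (0 ∷ 2 ∷ 5 ∷ 8 ∷ [])))) φ₂-unipotent) (3 ℕ.+ d))

-- The generating function modulo 2

module Modulo2 (M : ℕ) where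

  open Modulo 2 M
  open Congruence 2
  open Truncated M
  open CommutativeRing seriesRing
    hiding (zero) renaming (refl to ≈-refl; sym to ≈-sym; trans to ≈-trans; reflexive to ≈-reflexive)
  open Theta seriesRing using (2#)
  open Exp semiring using (_^_; ^-congˡ)
  open SetoidReasoning setoid

  2≋0 : 2# ≋ 0#
  2≋0 = coefficientwise λ { zero _ → congruent (Signed.divides (+ 1) refl) ; (suc _) _ → ~-refl }

  unipotent≋1 : ∀ {S a} → Unipotent S a → a ≋ 1#
  unipotent≋1 (u , a≋ , _) = ≈-trans a≋ (≈-trans (+-congˡ {1#} (≈-trans (*-congʳ {u} 2≋0) (zeroˡ u))) (+-identityʳ 1#))

  φ₂⁻¹≋1 : φ₂⁻¹ ≋ 1#
  φ₂⁻¹≋1 = ≈-trans (≈-sym (*-identityˡ φ₂⁻¹))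
    (≈-trans (*-congʳ {φ₂⁻¹} (≈-sym (unipotent≋1 φ₂-unipotent))) φ₂-unit)

  1^≋1 : ∀ k → 1# ^ k ≋ 1#
  1^≋1 zero    = ≈-refl
  1^≋1 (suc k) = ≈-trans (*-identityˡ (1# ^ k)) (1^≋1 k)

  abar≋1 : ∀ d → abar (2 ℕ.+ d) ≋ 1#
  abar≋1 d = begin
    abar (2 ℕ.+ d)             ≈⟨ abar-φ d ⟩
    φ * φ₂⁻¹ ^ (3 ℕ.+ d)       ≈⟨ *-cong {φ} {1#} {φ₂⁻¹ ^ (3 ℕ.+ d)} {1#} (unipotent≋1 φ-unipotent)
                                    (≈-trans (^-congˡ (3 ℕ.+ d) φ₂⁻¹≋1) (1^≋1 (3 ℕ.+ d))) ⟩
    1# * 1#                    ≈⟨ *-identityˡ 1# ⟩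
    1#                         ∎

-- Avoided residue classes and the resulting divisibilities

3n+2-residue : ∀ n → (2 ℕ.+ 3 ℕ.* n) % 9 ∉ 0 ∷ 1 ∷ 3 ∷ 4 ∷ 6 ∷ 7 ∷ []
3n+2-residue n = subst (_∉ 0 ∷ 1 ∷ 3 ∷ 4 ∷ 6 ∷ 7 ∷ [])
  (sym (trans (ℕ.%-distribˡ-+ 2 (3 ℕ.* n) 9) (cong (λ r → (2 ℕ.+ r) % 9) (ℕ.%-distribˡ-* 3 n 9))))
  (All.lookup (from-yes (all? (λ r → ¬? ((2 ℕ.+ (3 ℕ.* r) % 9) % 9 ∈? 0 ∷ 1 ∷ 3 ∷ 4 ∷ 6 ∷ 7 ∷ [])) (upTo 9)))
    (∈-upTo⁺ (ℕ.m%n<n n 9)))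

9n+3-residue : ∀ n → (3 ℕ.+ 9 ℕ.* n) % 9 ≡ 3
9n+3-residue n = trans (cong (λ k → (3 ℕ.+ k) % 9) (ℕ.*-comm 9 n)) (ℕ.[m+kn]%n≡m%n 3 n 9)

9n+3-∉ : ∀ {S} n → 3 ∉ S → (3 ℕ.+ 9 ℕ.* n) % 9 ∉ S
9n+3-∉ {S} n = subst (_∉ S) (sym (9n+3-residue n))

divides-6 : ∀ i n → 6 ℕ.∣ ℤ.∣ abar (2 ℕ.+ 3 ℕ.* i) (2 ℕ.+ 3 ℕ.* n) ∣
divides-6 i n = ℕ.lcm-least
  -- The truncation bound is the degree of the coefficient itself. This degree is a successor, so
  -- the coefficient of `1#` there reduces to 0.
  (~0⇒∣ (at (Modulo2.abar≋1 M (3 ℕ.* i)) M ℕ.≤-refl))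
  (~0⇒∣ (Modulo.supported-vanish 3 M (Modulo3.abar-3i+2-supported M i) ℕ.≤-refl (3n+2-residue n)))
  where
  M = 2 ℕ.+ 3 ℕ.* n
  open Congruence.Truncated 2 M

divides-12 : ∀ {S} d n → 3 ∉ S → (∀ M → Modulo.Supported 3 M S (abar (2 ℕ.+ d))) →
             12 ℕ.∣ ℤ.∣ abar (2 ℕ.+ d) (3 ℕ.+ 9 ℕ.* n) ∣
-- 12 is the least common multiple of 4 and 3; modulo 4 the class 3 is avoided for every d, modulo 3
-- the support depends on the family.
divides-12 d n 3∉S supported = ℕ.lcm-least
  (~0⇒∣ (Modulo.supported-vanish 4 M (Modulo4.abar-supported M d) ℕ.≤-refl
    (9n+3-∉ n (from-no (3 ∈? Modulo4.thetaResidues M)))))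
  (~0⇒∣ (Modulo.supported-vanish 3 M (supported M) ℕ.≤-refl (9n+3-∉ n 3∉S)))
  where
  M = 3 ℕ.+ 9 ℕ.* n

open import Data.Nat using (ℕ; _+_; _*_; _≤_)
open import Data.Integer.Divisibility using (_∣_)

theorem1p3 : (n i : ℕ) → 1 ≤ i →
    ((+ 6) ∣ abar (3 * i + 2) (3 * n + 2))
    × ((+ 12) ∣ abar (9 * i + 5) (9 * n + 3))
    × ((+ 12) ∣ abar (9 * i + 8) (9 * n + 3))
theorem1p3 n i _ =
    subst₂ (λ c k → (+ 6) ∣ abar c k) (ℕ.+-comm 2 (3 * i)) (ℕ.+-comm 2 (3 * n)) (divides-6 i n)
  , subst₂ (λ c k → (+ 12) ∣ abar c k) (ℕ.+-comm 5 (9 * i)) (ℕ.+-comm 3 (9 * n))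
      -- The argument d is c - 2, that is 9i + 3 here and 9i + 6 in the last case.
      (divides-12 (3 + 9 * i) n (from-no (3 ∈? 0 ∷ 1 ∷ 4 ∷ 6 ∷ 7 ∷ [])) (λ M → Modulo3.abar-9i+5-supported M i))
  , subst₂ (λ c k → (+ 12) ∣ abar c k) (ℕ.+-comm 8 (9 * i)) (ℕ.+-comm 3 (9 * n))
      (divides-12 (6 + 9 * i) n (from-no (3 ∈? 0 ∷ 1 ∷ 4 ∷ 7 ∷ [])) (λ M → Modulo3.abar-9i+8-supported M i))
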